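{- Let $G$ be a cubic graph. Then $$\gamma(G)\leq \left(\frac{7}{6}-\frac{1}{204}\right)\gamma_e(G).$$
   Context: All graphs are finite, simple, and undirected. A graph is cubic if it is $3$-regular, that is, every vertex has exactly $3$ neighbors. A set $D\subseteq V(G)$ is a dominating set in $G$ if every vertex in $V(G)\setminus D$ has a neighbor in $D$; the domination number $\gamma(G)$ is the minimum cardinality of a dominating set in $G$. A matching in $G$ is a set of pairwise disjoint edges of $G$; it is maximal if it is maximal with respect to inclusion among matchings in $G$ (equivalently, the set of vertices not incident with any edge of the matching is independent). The edge domination number $\gamma_e(G)$ is the minimum size (number of edges) of a maximal matching in $G$. -}

module Defs where

open import Data.Fin using (Fin; _<_; _<?_)
open import Data.Fin.Properties using (_≟_; all?; any?)
open import Data.Fin.Subset using (Subset; _∈_; _∉_; _⊂_; ∣_∣; ⊥; ⊤)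
open import Data.Fin.Subset.Induction using (Acc; acc; ⊃-wellFounded)
open import Data.Fin.Subset.Properties using (_∈?_; _⊂?_; anySubset?; ∉⊥; ∈⊤)
open import Data.List using (List; length; lookup; filter; cartesianProduct; allFin)
open import Data.Nat as ℕ using (ℕ; _≤_)
open import Data.Nat.Induction using (<-wellFounded)
import Data.Nat.Properties as ℕ
open import Data.Product using (∃; _×_; _,_; proj₁; proj₂)
open import Data.Sum using (_⊎_)
open import Data.Vec using (tabulate)
open import Level using (0ℓ)
open import Relation.Binary using (Rel; Irreflexive; Symmetric)
import Relation.Binary as B
open import Relation.Binary.PropositionalEquality using (_≡_; _≢_; refl)
open import Relation.Nullary using (¬_; Dec; yes; no; does; contradiction; _×-dec_; _⊎-dec_; _→-dec_; ¬?)
open import Relation.Nullary.Decidable using (map′)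
open import Relation.Unary using (Pred; Decidable)

-- A graph on a finite vertex set is, up to isomorphism, a graph on Fin n.
record Graph (n : ℕ) : Set₁ where
  infix 4 _~_ _~?_
  field
    _~_    : Rel (Fin n) 0ℓ
    _~?_   : B.Decidable _~_
    sym    : Symmetric _~_
    irrefl : Irreflexive _≡_ _~_

IsMinCardinality : ∀ {m} → Pred (Subset m) 0ℓ → Pred ℕ 0ℓ
IsMinCardinality P k = (∃ λ p → P p × ∣ p ∣ ≡ k) × (∀ p → P p → k ≤ ∣ p ∣)

minCardinality : ∀ {m} {P : Pred (Subset m) 0ℓ} → Decidable P → ∃ P → ∃ (IsMinCardinality P)
minCardinality {m} {P} P? (p₀ , Pp₀) = search p₀ Pp₀ (<-wellFounded ∣ p₀ ∣)
  where
  search : ∀ p → P p → Acc ℕ._<_ ∣ p ∣ → ∃ (IsMinCardinality P)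
  search p Pp (acc rs) with anySubset? (λ q → P? q ×-dec (∣ q ∣ ℕ.<? ∣ p ∣))
  ... | yes (q , Pq , q<p) = search q Pq (rs q<p)
  ... | no ¬smaller        =
    ∣ p ∣ , (p , Pp , refl) , λ q Pq → ℕ.≮⇒≥ λ q<p → ¬smaller (q , Pq , q<p)

module _ {n : ℕ} (G : Graph n) where
  open Graph G

  neighbours : Fin n → Subset n
  neighbours v = tabulate (λ w → does (v ~? w))

  Cubic : Set
  Cubic = ∀ v → ∣ neighbours v ∣ ≡ 3

  Dominating : Pred (Subset n) 0ℓ
  Dominating D = ∀ v → v ∉ D → ∃ λ u → u ∈ D × v ~ u

  dominating? : Decidable Dominating
  dominating? D = all? λ v → ¬? (v ∈? D) →-dec any? λ u → (u ∈? D) ×-dec (v ~? u)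

  ⊤-dominating : Dominating ⊤
  ⊤-dominating v v∉⊤ = contradiction ∈⊤ v∉⊤

  domination : ∃ (IsMinCardinality Dominating)
  domination = minCardinality dominating? (⊤ , ⊤-dominating)

  γ : ℕ
  γ = proj₁ domination

  -- Each undirected edge {u , v} is listed exactly once, as the pair with u < v.
  -- An edge is then a position in this list, and a set of edges a Subset of positions.
  edges : List (Fin n × Fin n)
  edges = filter (λ (u , v) → (u <? v) ×-dec (u ~? v)) (cartesianProduct (allFin n) (allFin n))

  Edge : Set
  Edge = Fin (length edges)

  EdgeSet : Set
  EdgeSet = Subset (length edges)

  Incident : Fin n → Edge → Set
  Incident v e = v ≡ proj₁ (lookup edges e) ⊎ v ≡ proj₂ (lookup edges e)

  Disjoint : Edge → Edge → Set
  Disjoint e f = ∀ v → ¬ (Incident v e × Incident v f)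

  Matching : Pred EdgeSet 0ℓ
  Matching M = ∀ e f → e ∈ M → f ∈ M → e ≢ f → Disjoint e f

  MaximalMatching : Pred EdgeSet 0ℓ
  MaximalMatching M = Matching M × (∀ M′ → Matching M′ → ¬ (M ⊂ M′))

  incident? : ∀ v e → Dec (Incident v e)
  incident? v e = (v ≟ _) ⊎-dec (v ≟ _)

  matching? : Decidable Matching
  matching? M = all? λ e → all? λ f →
    (e ∈? M) →-dec ((f ∈? M) →-dec (¬? (e ≟ f) →-dec
      all? λ v → ¬? (incident? v e ×-dec incident? v f)))

  larger? : ∀ M → Dec (∃ λ M′ → Matching M′ × M ⊂ M′)
  larger? M = anySubset? (λ M′ → matching? M′ ×-dec (M ⊂? M′))

  maximalMatching? : Decidable MaximalMatching
  maximalMatching? M = matching? M ×-dec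
    map′ (λ ¬larger M′ mM′ M⊂M′ → ¬larger (M′ , mM′ , M⊂M′))
         (λ maximal (M′ , mM′ , M⊂M′) → maximal M′ mM′ M⊂M′)
         (¬? (larger? M))

  maximalMatching-exists : ∃ MaximalMatching
  maximalMatching-exists = extend ⊥ (λ _ _ e∈⊥ → contradiction e∈⊥ ∉⊥) (⊃-wellFounded ⊥)
    where
    extend : ∀ M → Matching M → Acc (λ M′ M → M ⊂ M′) M → ∃ MaximalMatching
    extend M mM (acc rs) with larger? M
    ... | yes (M′ , mM′ , M⊂M′) = extend M′ mM′ (rs M⊂M′)
    ... | no ¬larger            = M , mM , λ M′ mM′ M⊂M′ → ¬larger (M′ , mM′ , M⊂M′)

  edgeDomination : ∃ (IsMinCardinality MaximalMatching)
  edgeDomination = minCardinality maximalMatching? maximalMatching-exists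

  γₑ : ℕ
  γₑ = proj₁ edgeDomination

{-# OPTIONS --safe #-}

-- Fix a minimum maximal matching M and choose one end of every edge of M. The chosen ends dominate
-- every vertex except those uncovered ones all of whose three neighbours were rejected. Such a vertex
-- is an unsatisfied clause of a 3-CNF whose variables are the edges of M; its literals are the ends of
-- these edges, and each occurs at most twice, as the third neighbour of an end is its partner. So one
-- has to leave clearly less than 1/8 of the N ≤ 4∣M∣/3 clauses unsatisfied.
--
-- Eight times the number u of unsatisfied clauses is a polynomial N + ∑ ± x_S in the signs x, where S
-- runs over the non-empty sets of variables of the clauses. Multiplying x by a sign vector g changes
-- the sign of exactly the monomials with g_S = −1, so for one of x and g · x these do not contribute
-- positively. Take a maximal family of k clauses with pairwise disjoint variables; then N ≤ 12k.
-- Every clause c contains a set T of two or three variables whose monomials do not cancel: at an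
-- assignment falsifying c, the monomials S ⊆ c of a clause d with ∣S∣ ≥ 2 add up to at least minus the
-- number of literals d shares with c, and to 4 if d = c, hence altogether to at least 7 − 6 = 1.
-- Choose such a T for each clause of the family. Sign vectors with g_T = 1 for all T remove
-- all monomials other than the x_T, and then flipping a variable of T makes x_T contribute at most −1.
-- Hence 8u ≤ N − k ≤ 11N/12, and γ ≤ ∣M∣ + u ≤ (83/72)∣M∣, where 83/72 < 7/6 − 1/204 = 79/68.

module Submission where

open import Defs
open import Data.Nat using (ℕ)
open import Data.Integer using (+_)
open import Data.Rational using (_/_; _≤_; _-_; _*_)

open import Data.Empty using (⊥-elim)
open import Data.Fin using (Fin; zero; suc)
import Data.Fin as Fin
import Data.Fin.Properties as Fin
open import Data.Fin.Subset as Subset using (Subset; inside; outside; ∣_∣; ⁅_⁆; _∪_)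
open import Data.Fin.Subset.Properties using (p⊆p∪q; x∈p∪q⁺; x∈p∪q⁻; x∈⁅x⁆; x∈⁅y⁆⇒x≡y)
import Data.Integer as ℤ
open ℤ using (ℤ; 0ℤ; 1ℤ)
import Data.Integer.Properties as ℤ
open import Data.Integer.Tactic.RingSolver using (solve-∀)
open import Data.List using (List; []; _∷_; [_]; _++_; map; filter; foldr; length; concat; concatMap; allFin; lookup; cartesianProduct)
import Data.List.Properties as List
open import Data.List.Membership.Propositional using (_∈_; _∉_; find; lose)
open import Data.List.Membership.Propositional.Properties
  using (∈-filter⁺; ∈-filter⁻; ∈-map⁺; ∈-map⁻; ∈-++⁺ˡ; ∈-++⁺ʳ; ∈-++⁻; ∈-concat⁺′; ∈-concat⁻′; ∈-allFin; ∈-∃++; ∈-lookup; ∈-cartesianProduct⁺)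
open import Data.List.Membership.Propositional.Properties.WithK using (unique∧set⇒bag)
open import Data.List.Relation.Binary.BagAndSetEquality using (∼bag⇒↭)
open import Data.List.Relation.Binary.Permutation.Propositional using (_↭_; refl; prep; swap; trans)
import Data.List.Relation.Binary.Permutation.Propositional.Properties as ↭
open import Data.List.Relation.Binary.Subset.Propositional using (_⊆_)
open import Data.List.Relation.Unary.All as All using (All; []; _∷_)
import Data.List.Relation.Unary.All.Properties as All
open import Data.List.Relation.Unary.AllPairs as AllPairs using (AllPairs; []; _∷_)
import Data.List.Relation.Unary.AllPairs.Properties as AllPairs
open import Data.List.Relation.Unary.Any as Any using (Any; here; there)
open import Data.List.Relation.Unary.Any.Properties using (lookup-index)
open import Data.List.Relation.Unary.Unique.Propositional using (Unique)
import Data.List.Relation.Unary.Unique.Propositional.Properties as Unique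
import Data.Nat as ℕ
import Data.Nat.Properties as ℕ
open import Data.Nat.Tactic.RingSolver using () renaming (solve-∀ to ℕ-solve-∀)
open import Data.Product using (∃; _×_; _,_; proj₁; proj₂)
open import Data.Product.Properties using (≡-dec)
open import Data.Rational using (toℚᵘ)
import Data.Rational.Properties as ℚ
open import Data.Rational.Unnormalised as ℚᵘ using (mkℚᵘ; *≤*)
import Data.Rational.Unnormalised.Properties as ℚᵘ
open import Data.Sign as Sign using (Sign; opposite)
import Data.Sign.Properties as Sign
import Algebra.Properties.CommutativeSemigroup Sign.*-commutativeSemigroup as Sign*
open import Data.Sum using (_⊎_; inj₁; inj₂; [_,_]′)
open import Data.Vec using ([]; _∷_; here; there; tabulate)
open import Data.Vec.Properties using (lookup∘tabulate; lookup⇒[]=; []=⇒lookup)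
open import Function using (_∘_; id)
open import Function.Bundles using (mk⇔)
open import Level using (0ℓ)
open import Relation.Binary using (DecidableEquality; tri<; tri≈; tri>)
open import Relation.Binary.PropositionalEquality
  using (_≡_; _≢_; refl; sym; cong; cong₂; subst; subst₂; module ≡-Reasoning) renaming (trans to ≡-trans)
open import Relation.Nullary using (¬_; Dec; yes; no; does; contradiction; ¬?; _×-dec_)
open import Relation.Nullary.Decidable using (dec-true)
open import Relation.Unary using (Pred; Decidable)

-- Sums and lists

module _ {A : Set} where

  ∑ : (A → ℤ) → List A → ℤ
  ∑ f = foldr (λ a s → f a ℤ.+ s) 0ℤ

  ∑-++ : ∀ f xs ys → ∑ f (xs ++ ys) ≡ ∑ f xs ℤ.+ ∑ f ys
  ∑-++ f []       ys = sym (ℤ.+-identityˡ _)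
  ∑-++ f (x ∷ xs) ys = ≡-trans (cong (ℤ._+_ (f x)) (∑-++ f xs ys)) (sym (ℤ.+-assoc (f x) _ _))

  ∑-nonneg : ∀ {f} xs → (∀ {x} → x ∈ xs → 0ℤ ℤ.≤ f x) → 0ℤ ℤ.≤ ∑ f xs
  ∑-nonneg []       0≤f = ℤ.≤-refl
  ∑-nonneg (x ∷ xs) 0≤f = ℤ.+-mono-≤ (0≤f (here refl)) (∑-nonneg xs (0≤f ∘ there))

  ≤-∑ : ∀ {f xs y} → y ∈ xs → (∀ {x} → x ∈ xs → 0ℤ ℤ.≤ f x) → f y ℤ.≤ ∑ f xs
  ≤-∑ {f} {x ∷ xs} (here refl) 0≤f =
    ℤ.≤-trans (ℤ.≤-reflexive (sym (ℤ.+-identityʳ (f x)))) (ℤ.+-monoʳ-≤ (f x) (∑-nonneg xs (0≤f ∘ there)))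
  ≤-∑ {f} {x ∷ xs} (there y∈) 0≤f =
    ℤ.≤-trans (ℤ.≤-reflexive (sym (ℤ.+-identityˡ _))) (ℤ.+-mono-≤ (0≤f (here refl)) (≤-∑ y∈ (0≤f ∘ there)))

  ∑-+ : ∀ f g xs → ∑ (λ x → f x ℤ.+ g x) xs ≡ ∑ f xs ℤ.+ ∑ g xs
  ∑-+ f g []       = refl
  ∑-+ f g (x ∷ xs) rewrite ∑-+ f g xs = interchange (f x) (g x) (∑ f xs) (∑ g xs)
    where
    interchange : ∀ a b c d → (a ℤ.+ b) ℤ.+ (c ℤ.+ d) ≡ (a ℤ.+ c) ℤ.+ (b ℤ.+ d)
    interchange = solve-∀

  ∑-filter : ∀ {P : Pred A 0ℓ} (P? : Decidable P) f xs →
             ∑ f xs ≡ ∑ f (filter P? xs) ℤ.+ ∑ f (filter (¬? ∘ P?) xs)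
  ∑-filter P? f []       = refl
  ∑-filter P? f (x ∷ xs) with P? x
  ... | yes _ = ≡-trans (cong (ℤ._+_ (f x)) (∑-filter P? f xs)) (sym (ℤ.+-assoc (f x) _ _))
  ... | no  _ = ≡-trans (cong (ℤ._+_ (f x)) (∑-filter P? f xs)) (rotate (f x) (∑ f (filter P? xs)) (∑ f (filter (¬? ∘ P?) xs)))
    where
    rotate : ∀ a b c → a ℤ.+ (b ℤ.+ c) ≡ b ℤ.+ (a ℤ.+ c)
    rotate = solve-∀

  filter-cong : ∀ {P Q : Pred A 0ℓ} (P? : Decidable P) (Q? : Decidable Q) xs →
                (∀ {x} → x ∈ xs → P x → Q x) → (∀ {x} → x ∈ xs → Q x → P x) →
                filter P? xs ≡ filter Q? xs
  filter-cong P? Q? []       P⇒Q Q⇒P = refl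
  filter-cong P? Q? (x ∷ xs) P⇒Q Q⇒P with P? x | Q? x
  ... | yes _ | yes _ = cong (x ∷_) (filter-cong P? Q? xs (P⇒Q ∘ there) (Q⇒P ∘ there))
  ... | no  _ | no  _ = filter-cong P? Q? xs (P⇒Q ∘ there) (Q⇒P ∘ there)
  ... | yes p | no ¬q = contradiction (P⇒Q (here refl) p) ¬q
  ... | no ¬p | yes q = contradiction (Q⇒P (here refl) q) ¬p

  filter-filter : ∀ {P Q : Pred A 0ℓ} (P? : Decidable P) (Q? : Decidable Q) xs →
                  (∀ {x} → x ∈ xs → P x → Q x) → filter P? (filter Q? xs) ≡ filter P? xs
  filter-filter P? Q? []       P⇒Q = refl
  filter-filter P? Q? (x ∷ xs) P⇒Q with Q? x
  filter-filter P? Q? (x ∷ xs) P⇒Q | yes q with P? x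
  ... | yes _ = cong (x ∷_) (filter-filter P? Q? xs (P⇒Q ∘ there))
  ... | no  _ = filter-filter P? Q? xs (P⇒Q ∘ there)
  filter-filter P? Q? (x ∷ xs) P⇒Q | no ¬q with P? x
  ... | yes p = contradiction (P⇒Q (here refl) p) ¬q
  ... | no  _ = filter-filter P? Q? xs (P⇒Q ∘ there)

∑-concatMap : ∀ {A B : Set} (f : B → ℤ) (g : A → List B) xs → ∑ f (concatMap g xs) ≡ ∑ (∑ f ∘ g) xs
∑-concatMap f g []       = refl
∑-concatMap f g (x ∷ xs) = ≡-trans (∑-++ f (g x) _) (cong (ℤ._+_ (∑ f (g x))) (∑-concatMap f g xs))

-- Sign polynomials and flips

⟦_⟧ : Sign → ℤ
⟦ s ⟧ = s ℤ.◃ 1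

⟦⟧-* : ∀ s t → ⟦ s Sign.* t ⟧ ≡ ⟦ s ⟧ ℤ.* ⟦ t ⟧
⟦⟧-* Sign.+ Sign.+ = refl
⟦⟧-* Sign.+ Sign.- = refl
⟦⟧-* Sign.- Sign.+ = refl
⟦⟧-* Sign.- Sign.- = refl

module _ {k : ℕ} where

  Literal Assignment : Set
  Literal    = Fin k × Sign
  Assignment = Fin k → Sign

  _≟ˡ_ : DecidableEquality Literal
  _≟ˡ_ = ≡-dec Fin._≟_ Sign._≟_

  vars : List Literal → List (Fin k)
  vars = map proj₁

  vars-length : ∀ S → length (vars S) ≡ length S
  vars-length = List.length-map proj₁

  -- The value + means that the literal is false: unsatisfied clauses are to contribute ∏ (1 + 1) = 8.
  falsity : Assignment → Literal → Sign
  falsity x (v , s) = opposite (s Sign.* x v)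

  val : Assignment → List Literal → Sign
  val x = foldr (λ l → falsity x l Sign.*_) Sign.+

  -- The factor by which flipping along `g` multiplies a monomial with variables `vs`.
  χ : Assignment → List (Fin k) → Sign
  χ g = foldr (λ v → g v Sign.*_) Sign.+

  infixr 7 _·_
  _·_ : Assignment → Assignment → Assignment
  (g · x) v = g v Sign.* x v

  falsity-· : ∀ g x v s → falsity (g · x) (v , s) ≡ g v Sign.* falsity x (v , s)
  falsity-· g x v s with g v | s | x v
  ... | Sign.+ | _      | _      = refl
  ... | Sign.- | Sign.+ | _      = refl
  ... | Sign.- | Sign.- | Sign.+ = refl
  ... | Sign.- | Sign.- | Sign.- = refl

  val-· : ∀ g x S → val (g · x) S ≡ χ g (vars S) Sign.* val x S
  val-· g x []            = refl
  val-· g x ((v , s) ∷ S) rewrite falsity-· g x v s | val-· g x S =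
    Sign*.interchange (g v) (falsity x (v , s)) (χ g (vars S)) (val x S)

  χ-· : ∀ g h vs → χ (g · h) vs ≡ χ g vs Sign.* χ h vs
  χ-· g h []       = refl
  χ-· g h (v ∷ vs) rewrite χ-· g h vs = Sign*.interchange (g v) (h v) (χ g vs) (χ h vs)

  χ-↭ : ∀ g {vs ws} → vs ↭ ws → χ g vs ≡ χ g ws
  χ-↭ g refl         = refl
  χ-↭ g (prep v p)   = cong (g v Sign.*_) (χ-↭ g p)
  χ-↭ g (swap {xs = vs} v w p) rewrite sym (χ-↭ g p) with g v | g w
  ... | Sign.+ | _      = refl
  ... | Sign.- | Sign.+ = refl
  ... | Sign.- | Sign.- = refl
  χ-↭ g (trans p q)  = ≡-trans (χ-↭ g p) (χ-↭ g q)

  -- A polynomial without constant term is a list of monomials with repetitions. The coefficient ±1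
  -- of a monomial is carried by the signs of its literals, and cancellation shows only in the
  -- value.
  eval : Assignment → List (List Literal) → ℤ
  eval x = ∑ (⟦_⟧ ∘ val x)

  Even : Assignment → List Literal → Set
  Even g S = χ g (vars S) ≡ Sign.+

  even? : ∀ g → Decidable (Even g)
  even? g S = χ g (vars S) Sign.≟ Sign.+

  evens odds : Assignment → List (List Literal) → List (List Literal)
  evens g = filter (even? g)
  odds  g = filter (¬? ∘ even? g)

  eval-split : ∀ g x Ts → eval x Ts ≡ eval x (evens g Ts) ℤ.+ eval x (odds g Ts)
  eval-split g x = ∑-filter (even? g) (⟦_⟧ ∘ val x)

  eval-flip : ∀ g x Ts → eval (g · x) Ts ≡ eval x (evens g Ts) ℤ.- eval x (odds g Ts)
  eval-flip g x []       = refl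
  eval-flip g x (S ∷ Ts) rewrite val-· g x S | eval-flip g x Ts with χ g (vars S)
  ... | Sign.+ = sym (ℤ.+-assoc ⟦ val x S ⟧ _ _)
  ... | Sign.- = ≡-trans (cong (ℤ._+ _) (⟦⟧-* Sign.- (val x S))) (shuffle ⟦ val x S ⟧ (eval x (evens g Ts)) (eval x (odds g Ts)))
    where
    shuffle : ∀ a b c → ℤ.-1ℤ ℤ.* a ℤ.+ (b ℤ.- c) ≡ b ℤ.- (a ℤ.+ c)
    shuffle = solve-∀

  -- The values at `x` and at `g · x` are the even part plus and minus the odd part. One of the two
  -- is therefore the even part less the absolute value of the odd part.
  better-flip : ∀ g x Ts → ∃ λ y → eval y Ts ℤ.+ + ℤ.∣ eval x (odds g Ts) ∣ ℤ.≤ eval x (evens g Ts)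
  better-flip g x Ts with eval x (odds g Ts) in eq
  ... | + n = g · x , ℤ.≤-reflexive (≡-trans (cong (ℤ._+ + n) (eval-flip g x Ts)) (lemma (eval x (evens g Ts)) (eval x (odds g Ts)) eq))
    where
    cancel : ∀ a b → (a ℤ.- b) ℤ.+ b ≡ a
    cancel = solve-∀
    lemma : ∀ a b → b ≡ + n → (a ℤ.- b) ℤ.+ + n ≡ a
    lemma a b refl = cancel a b
  ... | ℤ.-[1+ n ] = x , ℤ.≤-reflexive (≡-trans (cong (ℤ._+ + ℕ.suc n) (eval-split g x Ts)) (lemma (eval x (evens g Ts)) (eval x (odds g Ts)) eq))
    where
    cancel : ∀ a b → (a ℤ.+ b) ℤ.+ ℤ.- b ≡ a
    cancel = solve-∀
    lemma : ∀ a b → b ≡ ℤ.-[1+ n ] → (a ℤ.+ b) ℤ.+ + ℕ.suc n ≡ a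
    lemma a b refl = cancel a b

  kill : List Assignment → List (List Literal) → List (List Literal)
  kill []       Ts = Ts
  kill (g ∷ gs) Ts = kill gs (evens g Ts)

  ∈-kill⁻ : ∀ gs {Ts S} → S ∈ kill gs Ts → S ∈ Ts × All (λ g → Even g S) gs
  ∈-kill⁻ []       S∈ = S∈ , []
  ∈-kill⁻ (g ∷ gs) {Ts} S∈ with ∈-kill⁻ gs S∈
  ... | S∈′ , es with ∈-filter⁻ (even? g) {xs = Ts} S∈′
  ... | S∈Ts , e = S∈Ts , e ∷ es

  filter-kill : ∀ {P : Pred (List Literal) 0ℓ} (P? : Decidable P) gs Ts →
                (∀ {S} → S ∈ Ts → P S → All (λ g → Even g S) gs) →
                filter P? (kill gs Ts) ≡ filter P? Ts
  filter-kill P? []       Ts P⇒e = refl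
  filter-kill P? (g ∷ gs) Ts P⇒e =
    ≡-trans (filter-kill P? gs (evens g Ts) (λ S∈ → All.tail ∘ P⇒e (proj₁ (∈-filter⁻ (even? g) {xs = Ts} S∈))))
            (filter-filter P? (even? g) Ts (λ S∈ → All.head ∘ P⇒e S∈))

  -- Going back from `evens g Ts` to `Ts`, the better of `y` and `g · y` is taken, so restoring the
  -- removed monomials never raises the value.
  kill-≤ : ∀ gs Ts x → ∃ λ y → eval y Ts ℤ.≤ eval x (kill gs Ts)
  kill-≤ []       Ts x = x , ℤ.≤-refl
  kill-≤ (g ∷ gs) Ts x with kill-≤ gs (evens g Ts) x
  ... | y , y≤ with better-flip g y Ts
  ... | z , z≤ = z , ℤ.≤-trans (ℤ.≤-trans (ℤ.i≤i+j (eval z Ts) _) z≤) y≤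

  -- An odd part that is a non-zero integer gains at least 1. It has to be non-zero everywhere,
  -- since the assignment at which it is evaluated only comes out of the recursion. The pairwise
  -- condition says that removing the odd monomials of an earlier flip leaves those of every later
  -- flip intact.
  kill-gain : ∀ gs Ts x →
              All (λ g → ∀ y → eval y (odds g Ts) ≢ 0ℤ) gs →
              AllPairs (λ g h → ∀ S → S ∈ Ts → ¬ Even h S → Even g S) gs →
              ∃ λ y → eval y Ts ℤ.+ + length gs ℤ.≤ eval x (kill gs Ts)
  kill-gain []       Ts x _ _ = x , ℤ.≤-reflexive (ℤ.+-identityʳ _)
  kill-gain (g ∷ gs) Ts x (g≢0 ∷ gs≢0) (g-gs ∷ gs-gs)
    with kill-gain gs (evens g Ts) x
      (All.zipWith (λ {h} (h≢0 , g-h) y eq → h≢0 y (≡-trans (cong (eval y) (sym (filter-filter (¬? ∘ even? h) (even? g) Ts (g-h _)))) eq)) (gs≢0 , g-gs))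
      (AllPairs.map (λ p S S∈ → p S (proj₁ (∈-filter⁻ (even? g) {xs = Ts} S∈))) gs-gs)
  ... | y , y≤ with better-flip g y Ts
  ... | z , z≤ = z , ℤ.≤-trans step y≤
    where
    open ℤ.≤-Reasoning
    nz : ∀ i → i ≢ 0ℤ → 1 ℕ.≤ ℤ.∣ i ∣
    nz (+ ℕ.zero) ne = ⊥-elim (ne refl)
    nz (+ ℕ.suc n) ne = ℕ.s≤s ℕ.z≤n
    nz ℤ.-[1+ n ] ne = ℕ.s≤s ℕ.z≤n
    step : eval z Ts ℤ.+ + ℕ.suc (length gs) ℤ.≤ eval y (evens g Ts) ℤ.+ + length gs
    step = begin
      eval z Ts ℤ.+ (1ℤ ℤ.+ + length gs)  ≡⟨ ℤ.+-assoc (eval z Ts) 1ℤ (+ length gs) ⟨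
      (eval z Ts ℤ.+ 1ℤ) ℤ.+ + length gs  ≤⟨ ℤ.+-monoˡ-≤ (+ length gs) (ℤ.+-monoʳ-≤ (eval z Ts) (ℤ.+≤+ (nz (eval y (odds g Ts)) (g≢0 y)))) ⟩
      (eval z Ts ℤ.+ + ℤ.∣ eval y (odds g Ts) ∣) ℤ.+ + length gs  ≤⟨ ℤ.+-monoˡ-≤ (+ length gs) z≤ ⟩
      eval y (evens g Ts) ℤ.+ + length gs  ∎

-- Covers, independent families and equivalence classes in lists

length-≤-cover : ∀ {A B : Set} {P : B → Pred A 0ℓ} (P? : ∀ b → Decidable (P b)) m bs xs →
                 (∀ {x} → x ∈ xs → Any (λ b → P b x) bs) →
                 (∀ {b} → b ∈ bs → length (filter (P? b) xs) ℕ.≤ m) →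
                 length xs ℕ.≤ length bs ℕ.* m
length-≤-cover P? m []       []       cov bnd = ℕ.z≤n
length-≤-cover P? m []       (x ∷ xs) cov bnd with () ← cov (here refl)
length-≤-cover {P = P} P? m (b ∷ bs) xs cov bnd = begin
  length xs                                                       ≡⟨ length-split xs ⟩
  -- Union bound: `b` accounts for at most `m` elements, and what is left is covered by `bs`.
  length (filter (P? b) xs) ℕ.+ length rest                       ≤⟨ ℕ.+-mono-≤ (bnd (here refl)) (length-≤-cover P? m bs rest cov′ bnd′) ⟩
  m ℕ.+ length bs ℕ.* m                                           ∎
  where
  open ℕ.≤-Reasoning
  rest = filter (¬? ∘ P? b) xs
  length-split : ∀ xs → length xs ≡ length (filter (P? b) xs) ℕ.+ length (filter (¬? ∘ P? b) xs)
  length-split []       = refl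
  length-split (x ∷ xs) with P? b x
  ... | yes _ = cong ℕ.suc (length-split xs)
  ... | no  _ = ≡-trans (cong ℕ.suc (length-split xs)) (sym (ℕ.+-suc _ _))
  cov′ : ∀ {x} → x ∈ rest → Any (λ b → P b x) bs
  cov′ x∈ with ∈-filter⁻ (¬? ∘ P? b) {xs = xs} x∈
  ... | x∈xs , ¬p with cov x∈xs
  ... | here  p   = contradiction p ¬p
  ... | there any = any
  length-filter-filter : ∀ c xs → length (filter (P? c) (filter (¬? ∘ P? b) xs)) ℕ.≤ length (filter (P? c) xs)
  length-filter-filter c []       = ℕ.z≤n
  length-filter-filter c (x ∷ xs) with P? b x
  length-filter-filter c (x ∷ xs) | yes _ with P? c x
  ... | yes _ = ℕ.m≤n⇒m≤1+n (length-filter-filter c xs)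
  ... | no  _ = length-filter-filter c xs
  length-filter-filter c (x ∷ xs) | no  _ with P? c x
  ... | yes _ = ℕ.s≤s (length-filter-filter c xs)
  ... | no  _ = length-filter-filter c xs
  bnd′ : ∀ {c} → c ∈ bs → length (filter (P? c) rest) ℕ.≤ m
  bnd′ {c} c∈ = ℕ.≤-trans (length-filter-filter c xs) (bnd (there c∈))

module _ {A : Set} where

  -- Greedy choice from the end of the list: an element joins unless it is related to one already
  -- chosen, and an element that joins is related to itself.
  maximal-independent : ∀ {R : A → A → Set} (R? : ∀ a b → Dec (R a b)) xs → (∀ {x} → x ∈ xs → R x x) →
                        ∃ λ ys → ys ⊆ xs × AllPairs (λ a b → ¬ R a b) ys ×
                                 (∀ {x} → x ∈ xs → Any (R x) ys)
  maximal-independent R? []       Rxx = [] , id , [] , λ ()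
  maximal-independent R? (x ∷ xs) Rxx with maximal-independent R? xs (Rxx ∘ there)
  ... | ys , ys⊆ , indep , dom with Any.any? (R? x) ys
  ... | yes hit = ys , there ∘ ys⊆ , indep , λ { (here refl) → hit ; (there x∈) → dom x∈ }
  ... | no ¬hit = x ∷ ys , (λ { (here eq) → here eq ; (there y∈) → there (ys⊆ y∈) }) ,
                  All.¬Any⇒All¬ ys ¬hit ∷ indep ,
                  λ { (here refl) → here (Rxx (here refl)) ; (there x∈) → there (dom x∈) }

  unique-↭ : ∀ {xs ys : List A} → Unique xs → Unique ys → xs ⊆ ys → ys ⊆ xs → xs ↭ ys
  unique-↭ uxs uys xs⊆ys ys⊆xs = ∼bag⇒↭ (unique∧set⇒bag uxs uys (mk⇔ xs⊆ys ys⊆xs))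

  unique-⊆-length : ∀ {xs ys : List A} → Unique xs → xs ⊆ ys → length xs ℕ.≤ length ys
  unique-⊆-length {[]}     []         xs⊆ys = ℕ.z≤n
  unique-⊆-length {x ∷ xs} (x∉ ∷ uxs) xs⊆ys with ∈-∃++ (xs⊆ys (here refl))
  ... | as , bs , refl = subst (ℕ.suc (length xs) ℕ.≤_) (sym (↭.↭-length (↭.shift x as bs)))
                           (ℕ.s≤s (unique-⊆-length uxs λ y∈ → drop-x y∈ (xs⊆ys (there y∈))))
    where
    drop-x : ∀ {y} → y ∈ xs → y ∈ as ++ x ∷ bs → y ∈ as ++ bs
    drop-x y∈xs y∈ with ∈-++⁻ as y∈
    ... | inj₁ y∈as         = ∈-++⁺ˡ y∈as
    ... | inj₂ (here refl)  = contradiction refl (All.lookup x∉ y∈xs)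
    ... | inj₂ (there y∈bs) = ∈-++⁺ʳ as y∈bs

  AllPairs-∈ : ∀ {R : A → A → Set} {xs x y} → AllPairs R xs → x ∈ xs → y ∈ xs → x ≡ y ⊎ R x y ⊎ R y x
  AllPairs-∈ (r ∷ rs) (here refl) (here refl) = inj₁ refl
  AllPairs-∈ (r ∷ rs) (here refl) (there y∈)  = inj₂ (inj₁ (All.lookup r y∈))
  AllPairs-∈ (r ∷ rs) (there x∈)  (here refl) = inj₂ (inj₂ (All.lookup r x∈))
  AllPairs-∈ (r ∷ rs) (there x∈)  (there y∈)  = AllPairs-∈ rs x∈ y∈

  -- The condition `R a c → R b c → R a b` and reflexivity make `R` an equivalence, so its classes
  -- split the sum. If the class of the first element contributes at most 0, the remaining elements
  -- still have a positive sum.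
  positive-class : ∀ {R : A → A → Set} (R? : ∀ a b → Dec (R a b)) →
                   (∀ {a b c} → R a c → R b c → R a b) → (∀ {a} → R a a) → ∀ f xs → 1ℤ ℤ.≤ ∑ f xs →
                   ∃ λ y → y ∈ xs × 1ℤ ℤ.≤ ∑ f (filter (R? y) xs)
  positive-class {R} R? euclid rfl f xs = go (length xs) xs ℕ.≤-refl
    where
    go : ∀ n xs → length xs ℕ.≤ n → 1ℤ ℤ.≤ ∑ f xs → ∃ λ y → y ∈ xs × 1ℤ ℤ.≤ ∑ f (filter (R? y) xs)
    go n         []       _   (ℤ.+≤+ ())
    go (ℕ.suc n) (x ∷ xs) (ℕ.s≤s ≤n) pos with 1ℤ ℤ.≤? ∑ f (filter (R? x) (x ∷ xs))
    ... | yes p = x , here refl , p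
    ... | no ¬p with go n rest (ℕ.≤-trans short ≤n) pos-rest
      where
      rest = filter (¬? ∘ R? x) (x ∷ xs)
      short : length rest ℕ.≤ length xs
      short = ℕ.≤-pred (List.filter-notAll (¬? ∘ R? x) (x ∷ xs) (here (λ ¬r → ¬r rfl)))
      class≤0 : ∑ f (filter (R? x) (x ∷ xs)) ℤ.≤ 0ℤ
      class≤0 = ℤ.i<j⇒i≤pred[j] (ℤ.≰⇒> ¬p)
      pos-rest : 1ℤ ℤ.≤ ∑ f rest
      pos-rest = begin
        1ℤ ≤⟨ pos ⟩
        ∑ f (x ∷ xs) ≡⟨ ∑-filter (R? x) f (x ∷ xs) ⟩
        ∑ f (filter (R? x) (x ∷ xs)) ℤ.+ ∑ f rest ≤⟨ ℤ.+-monoˡ-≤ (∑ f rest) class≤0 ⟩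
        0ℤ ℤ.+ ∑ f rest ≡⟨ ℤ.+-identityˡ _ ⟩
        ∑ f rest ∎
        where open ℤ.≤-Reasoning
    ... | y , y∈ , p with ∈-filter⁻ (¬? ∘ R? x) {xs = x ∷ xs} y∈
    -- As `y` lies outside the class of `x`, removing that class took nothing from the class of `y`.
    ... | y∈xs , ¬xRy = y , y∈xs , subst (λ zs → 1ℤ ℤ.≤ ∑ f zs)
                          (filter-filter (R? y) (¬? ∘ R? x) (x ∷ xs) (λ _ yRz xRz → ¬xRy (euclid xRz yRz))) p

-- Expansion of a clause into monomials

module _ {k : ℕ} where
  open import Data.List.Membership.DecPropositional (Fin._≟_ {k}) using (_∈?_)
  open import Data.List.Relation.Binary.Subset.DecPropositional (Fin._≟_ {k}) using (_⊆?_)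

  -- The non-empty sublists: the monomials other than 1 in the product of the factors 1 + τ, where τ
  -- is the value ±1 of a literal.
  expand : List (Literal {k}) → List (List (Literal {k}))
  expand []      = []
  expand (l ∷ d) = [ l ] ∷ map (l ∷_) (expand d) ++ expand d

  expand-AllPairs : ∀ {R : Literal → Literal → Set} {d} → AllPairs R d → ∀ {S} → S ∈ expand d → AllPairs R S × S ⊆ d
  expand-AllPairs {R} {l ∷ d} (r ∷ rs) (here refl) = [] ∷ [] , λ { (here eq) → here eq }
  expand-AllPairs {R} {l ∷ d} (r ∷ rs) (there S∈) with ∈-++⁻ (map (l ∷_) (expand d)) S∈
  ... | inj₂ S∈d with expand-AllPairs rs S∈d
  ... | rS , S⊆d = rS , there ∘ S⊆d
  expand-AllPairs {R} {l ∷ d} (r ∷ rs) (there S∈) | inj₁ S∈l with ∈-map⁻ (l ∷_) S∈l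
  ... | S′ , S′∈ , refl with expand-AllPairs rs S′∈
  ... | rS , S⊆d = All.tabulate (All.lookup r ∘ S⊆d) ∷ rS ,
                   λ { (here eq) → here eq ; (there m∈) → there (S⊆d m∈) }

  expand-nonempty : ∀ d {S} → S ∈ expand d → 1 ℕ.≤ length S
  expand-nonempty (l ∷ d) (here refl) = ℕ.≤-refl
  expand-nonempty (l ∷ d) (there S∈) with ∈-++⁻ (map (l ∷_) (expand d)) S∈
  ... | inj₂ S∈d = expand-nonempty d S∈d
  ... | inj₁ S∈l with ∈-map⁻ (l ∷_) S∈l
  ... | _ , _ , refl = ℕ.s≤s ℕ.z≤n

  eval-++ : ∀ x (Ss Ts : List (List (Literal {k}))) → eval x (Ss ++ Ts) ≡ eval x Ss ℤ.+ eval x Ts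
  eval-++ x = ∑-++ (⟦_⟧ ∘ val x)

  eval-∷ : ∀ x (l : Literal {k}) Ts → eval x (map (l ∷_) Ts) ≡ ⟦ falsity x l ⟧ ℤ.* eval x Ts
  eval-∷ x l []       = sym (ℤ.*-zeroʳ ⟦ falsity x l ⟧)
  eval-∷ x l (S ∷ Ts) = begin
    ⟦ falsity x l Sign.* val x S ⟧ ℤ.+ eval x (map (l ∷_) Ts)
      ≡⟨ cong₂ ℤ._+_ (⟦⟧-* (falsity x l) (val x S)) (eval-∷ x l Ts) ⟩
    ⟦ falsity x l ⟧ ℤ.* ⟦ val x S ⟧ ℤ.+ ⟦ falsity x l ⟧ ℤ.* eval x Ts
      ≡⟨ ℤ.*-distribˡ-+ ⟦ falsity x l ⟧ _ _ ⟨
    ⟦ falsity x l ⟧ ℤ.* eval x (S ∷ Ts) ∎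
    where open ≡-Reasoning

  -- A false literal gives the factor 2 and a true one the factor 0, so a clause of three literals
  -- yields 8 if it is unsatisfied and 0 otherwise.
  ∏ : Assignment → List (Literal {k}) → ℤ
  ∏ x = foldr (λ l p → (1ℤ ℤ.+ ⟦ falsity x l ⟧) ℤ.* p) 1ℤ

  ∏-expand : ∀ x d → ∏ x d ≡ 1ℤ ℤ.+ eval x (expand d)
  ∏-expand x []      = refl
  ∏-expand x (l ∷ d) = begin
    (1ℤ ℤ.+ τ) ℤ.* ∏ x d                                  ≡⟨ cong ((1ℤ ℤ.+ τ) ℤ.*_) (∏-expand x d) ⟩
    (1ℤ ℤ.+ τ) ℤ.* (1ℤ ℤ.+ e)                             ≡⟨ factor τ e ⟩
    1ℤ ℤ.+ (τ ℤ.+ (τ ℤ.* e ℤ.+ e))                        ≡⟨ cong₂ (λ t r → 1ℤ ℤ.+ (t ℤ.+ (r ℤ.+ e))) ⟦singleton⟧ (eval-∷ x l (expand d)) ⟨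
    1ℤ ℤ.+ (⟦ val x [ l ] ⟧ ℤ.+ (eval x (map (l ∷_) (expand d)) ℤ.+ e))
      ≡⟨ cong (λ r → 1ℤ ℤ.+ (⟦ val x [ l ] ⟧ ℤ.+ r)) (eval-++ x (map (l ∷_) (expand d)) (expand d)) ⟨
    1ℤ ℤ.+ eval x (expand (l ∷ d))                        ∎
    where
    open ≡-Reasoning
    τ = ⟦ falsity x l ⟧
    e = eval x (expand d)
    ⟦singleton⟧ : ⟦ val x [ l ] ⟧ ≡ τ
    ⟦singleton⟧ = cong ⟦_⟧ (Sign.*-identityʳ (falsity x l))
    factor : ∀ t e → (1ℤ ℤ.+ t) ℤ.* (1ℤ ℤ.+ e) ≡ 1ℤ ℤ.+ (t ℤ.+ (t ℤ.* e ℤ.+ e))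
    factor = solve-∀

  ∏-nonneg : ∀ x d → 0ℤ ℤ.≤ ∏ x d
  ∏-nonneg x []      = ℤ.+≤+ ℕ.z≤n
  ∏-nonneg x (l ∷ d) with falsity x l
  ... | Sign.- = ℤ.≤-refl
  ... | Sign.+ = ℤ.*-monoˡ-≤-nonNeg (+ 2) (∏-nonneg x d)

  False : Assignment → Pred (Literal {k}) 0ℓ
  False x l = falsity x l ≡ Sign.+

  false? : ∀ x → Decidable (False x)
  false? x l = falsity x l Sign.≟ Sign.+

  restrict : List (Fin k) → List (Literal {k}) → List (Literal {k})
  restrict U = filter (λ l → proj₁ l ∈? U)

  within? : ∀ U (S : List (Literal {k})) → Dec (vars S ⊆ U)
  within? U S = vars S ⊆? U

  -- Allows `big-bound` to be applied to the part of a clause that lies on the variables of another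
  -- clause.
  filter-within : ∀ U d → filter (within? U) (expand d) ≡ expand (restrict U d)
  filter-within U []      = refl
  filter-within U (l ∷ d) = go (proj₁ l ∈? U)
    where
    open ≡-Reasoning
    filter-∷ : proj₁ l ∈ U → ∀ Ts → filter (within? U) (map (l ∷_) Ts) ≡ map (l ∷_) (filter (within? U) Ts)
    filter-∷ l∈ []       = refl
    filter-∷ l∈ (S ∷ Ts) with within? U S
    ... | yes S⊆ = ≡-trans (List.filter-accept (within? U) λ { (here refl) → l∈ ; (there v∈) → S⊆ v∈ }) (cong ((l ∷ S) ∷_) (filter-∷ l∈ Ts))
    ... | no  S⊈ = ≡-trans (List.filter-reject (within? U) λ lS⊆ → S⊈ (lS⊆ ∘ there)) (filter-∷ l∈ Ts)
    go : Dec (proj₁ l ∈ U) → filter (within? U) (expand (l ∷ d)) ≡ expand (restrict U (l ∷ d))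
    go (yes l∈) = begin
      filter (within? U) ([ l ] ∷ map (l ∷_) (expand d) ++ expand d)
        ≡⟨ List.filter-accept (within? U) (λ { (here refl) → l∈ }) ⟩
      [ l ] ∷ filter (within? U) (map (l ∷_) (expand d) ++ expand d)
        ≡⟨ cong ([ l ] ∷_) (List.filter-++ (within? U) (map (l ∷_) (expand d)) (expand d)) ⟩
      [ l ] ∷ filter (within? U) (map (l ∷_) (expand d)) ++ filter (within? U) (expand d)
        ≡⟨ cong₂ (λ p q → [ l ] ∷ p ++ q) (≡-trans (filter-∷ l∈ (expand d)) (cong (map (l ∷_)) (filter-within U d))) (filter-within U d) ⟩
      expand (l ∷ restrict U d)
        ≡⟨ cong expand (List.filter-accept (λ l → proj₁ l ∈? U) l∈) ⟨
      expand (restrict U (l ∷ d)) ∎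
    go (no l∉) = begin
      filter (within? U) ([ l ] ∷ map (l ∷_) (expand d) ++ expand d)
        ≡⟨ List.filter-reject (within? U) (λ S⊆ → l∉ (S⊆ (here refl))) ⟩
      filter (within? U) (map (l ∷_) (expand d) ++ expand d)
        ≡⟨ List.filter-++ (within? U) (map (l ∷_) (expand d)) (expand d) ⟩
      filter (within? U) (map (l ∷_) (expand d)) ++ filter (within? U) (expand d)
        ≡⟨ cong₂ _++_ (List.filter-none (within? U) (All.map⁺ (All.universal (λ S S⊆ → l∉ (S⊆ (here refl))) (expand d)))) (filter-within U d) ⟩
      expand (restrict U d)
        ≡⟨ cong expand (List.filter-reject (λ l → proj₁ l ∈? U) l∉) ⟨
      expand (restrict U (l ∷ d)) ∎

  big? : ∀ (S : List (Literal {k})) → Dec (2 ℕ.≤ length S)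
  big? S = 2 ℕ.≤? length S

  filter-big : ∀ l d → filter big? (expand (l ∷ d)) ≡ map (l ∷_) (expand d) ++ filter big? (expand d)
  filter-big l d = begin
    filter big? ([ l ] ∷ map (l ∷_) (expand d) ++ expand d)
      ≡⟨ List.filter-reject big? {[ l ]} {map (l ∷_) (expand d) ++ expand d} (λ { (ℕ.s≤s ()) }) ⟩
    filter big? (map (l ∷_) (expand d) ++ expand d)
      ≡⟨ List.filter-++ big? (map (l ∷_) (expand d)) (expand d) ⟩
    filter big? (map (l ∷_) (expand d)) ++ filter big? (expand d)
      ≡⟨ cong (_++ filter big? (expand d)) (List.filter-all big? (All.map⁺ (All.tabulate (ℕ.s≤s ∘ expand-nonempty d)))) ⟩
    map (l ∷_) (expand d) ++ filter big? (expand d) ∎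
    where open ≡-Reasoning

  #false : Assignment → List (Literal {k}) → ℤ
  #false x d = + length (filter (false? x) d)

  -- Writing τ for the value ±1 of a literal, the middle sum is ∏(1 + τ) − 1 − ∑τ, so that
  -- adding #{τ = 1} gives ∏(1 + τ) − 1 + #{τ = −1}.
  big-bound : ∀ x d → 0ℤ ℤ.≤ eval x (filter big? (expand d)) ℤ.+ #false x d ×
                      ∏ x d ℤ.≤ 1ℤ ℤ.+ (eval x (filter big? (expand d)) ℤ.+ #false x d)
  big-bound x []      = ℤ.≤-refl , ℤ.≤-refl
  big-bound x (l ∷ d) = subst (λ i → 0ℤ ℤ.≤ i ℤ.+ #false x (l ∷ d) × ∏ x (l ∷ d) ℤ.≤ 1ℤ ℤ.+ (i ℤ.+ #false x (l ∷ d)))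
    (sym (≡-trans (cong (eval x) (filter-big l d))
      (≡-trans (eval-++ x (map (l ∷_) (expand d)) (filter big? (expand d))) (cong (ℤ._+ b) (eval-∷ x l (expand d))))))
    step
    where
    open ℤ.≤-Reasoning
    e = eval x (expand d)
    b = eval x (filter big? (expand d))
    f = #false x d
    0≤b+f   = proj₁ (big-bound x d)
    ∏≤1+b+f = proj₂ (big-bound x d)
    step : 0ℤ ℤ.≤ (⟦ falsity x l ⟧ ℤ.* e ℤ.+ b) ℤ.+ #false x (l ∷ d) ×
           ∏ x (l ∷ d) ℤ.≤ 1ℤ ℤ.+ ((⟦ falsity x l ⟧ ℤ.* e ℤ.+ b) ℤ.+ #false x (l ∷ d))
    step with falsity x l
    ... | Sign.+ =
      (begin
        0ℤ                                      ≤⟨ ℤ.+-mono-≤ (∏-nonneg x d) 0≤b+f ⟩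
        ∏ x d ℤ.+ (b ℤ.+ f)                     ≡⟨ eq ⟩
        (1ℤ ℤ.* e ℤ.+ b) ℤ.+ (1ℤ ℤ.+ f)         ∎) ,
      (begin
        + 2 ℤ.* ∏ x d                           ≡⟨ double (∏ x d) ⟩
        ∏ x d ℤ.+ ∏ x d                         ≤⟨ ℤ.+-monoʳ-≤ (∏ x d) ∏≤1+b+f ⟩
        ∏ x d ℤ.+ (1ℤ ℤ.+ (b ℤ.+ f))            ≡⟨ swap-1 (∏ x d) (b ℤ.+ f) ⟩
        1ℤ ℤ.+ (∏ x d ℤ.+ (b ℤ.+ f))            ≡⟨ cong (ℤ._+_ 1ℤ) eq ⟩
        1ℤ ℤ.+ ((1ℤ ℤ.* e ℤ.+ b) ℤ.+ (1ℤ ℤ.+ f)) ∎)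
      where
      double : ∀ p → + 2 ℤ.* p ≡ p ℤ.+ p
      double = solve-∀
      swap-1 : ∀ p q → p ℤ.+ (1ℤ ℤ.+ q) ≡ 1ℤ ℤ.+ (p ℤ.+ q)
      swap-1 = solve-∀
      regroup : ∀ e b f → (1ℤ ℤ.+ e) ℤ.+ (b ℤ.+ f) ≡ (1ℤ ℤ.* e ℤ.+ b) ℤ.+ (1ℤ ℤ.+ f)
      regroup = solve-∀
      eq : ∏ x d ℤ.+ (b ℤ.+ f) ≡ (1ℤ ℤ.* e ℤ.+ b) ℤ.+ (1ℤ ℤ.+ f)
      eq = ≡-trans (cong (ℤ._+ (b ℤ.+ f)) (∏-expand x d)) (regroup e b f)
    -- A true literal makes the product 0, so the second bound follows from the first. The first
    -- comes from the second bound for `d`, which is why both are proved together.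
    ... | Sign.- = nonneg , ℤ.≤-trans nonneg (ℤ.i≤j+i _ 1ℤ)
      where
      regroup : ∀ e b f → (1ℤ ℤ.+ (b ℤ.+ f)) ℤ.- (1ℤ ℤ.+ e) ≡ (ℤ.-1ℤ ℤ.* e ℤ.+ b) ℤ.+ f
      regroup = solve-∀
      nonneg : 0ℤ ℤ.≤ (ℤ.-1ℤ ℤ.* e ℤ.+ b) ℤ.+ f
      nonneg = begin
        0ℤ                                      ≤⟨ ℤ.i≤j⇒0≤j-i ∏≤1+b+f ⟩
        (1ℤ ℤ.+ (b ℤ.+ f)) ℤ.- ∏ x d            ≡⟨ cong (ℤ._-_ (1ℤ ℤ.+ (b ℤ.+ f))) (∏-expand x d) ⟩
        (1ℤ ℤ.+ (b ℤ.+ f)) ℤ.- (1ℤ ℤ.+ e)       ≡⟨ regroup e b f ⟩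
        (ℤ.-1ℤ ℤ.* e ℤ.+ b) ℤ.+ f               ∎

-- Every clause contains monomials that do not cancel

filter-concatMap : ∀ {A B : Set} {P : Pred B 0ℓ} (P? : Decidable P) (g : A → List B) xs →
                   filter P? (concatMap g xs) ≡ concatMap (filter P? ∘ g) xs
filter-concatMap P? g []       = refl
filter-concatMap P? g (x ∷ xs) =
  ≡-trans (List.filter-++ P? (g x) (concatMap g xs)) (cong (filter P? (g x) ++_) (filter-concatMap P? g xs))

∑-length-filter : ∀ {A : Set} {P : Pred A 0ℓ} (P? : Decidable P) xss →
                  ∑ (λ xs → + length (filter P? xs)) xss ≡ + length (filter P? (concat xss))
∑-length-filter P? []         = refl
∑-length-filter P? (xs ∷ xss) = begin
  + length (filter P? xs) ℤ.+ ∑ (λ xs → + length (filter P? xs)) xss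
    ≡⟨ cong (ℤ._+_ (+ length (filter P? xs))) (∑-length-filter P? xss) ⟩
  + (length (filter P? xs) ℕ.+ length (filter P? (concat xss)))
    ≡⟨ cong +_ (List.length-++ (filter P? xs)) ⟨
  + length (filter P? xs ++ filter P? (concat xss))
    ≡⟨ cong (+_ ∘ length) (List.filter-++ P? xs (concat xss)) ⟨
  + length (filter P? (xs ++ concat xss)) ∎
  where open ≡-Reasoning

module _ {k : ℕ} where
  open import Data.List.Membership.DecPropositional (Fin._≟_ {k}) using (_∈?_)
  open import Data.List.Membership.DecPropositional (_≟ˡ_ {k}) using () renaming (_∈?_ to _∈ˡ?_)
  open import Data.List.Relation.Binary.Subset.DecPropositional (Fin._≟_ {k}) using (_⊆?_)

  -- Variables outside `c` get the default value `Sign.+`; a false literal is thus known to belong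
  -- to `c` only if its variable occurs in `c`.
  falsify : List (Literal {k}) → Assignment {k}
  falsify c v with (v , Sign.+) ∈ˡ? c
  ... | yes _ = Sign.-
  ... | no  _ = Sign.+

  unique-var : ∀ {c : List (Literal {k})} {v s t} → Unique (vars c) → (v , s) ∈ c → (v , t) ∈ c → s ≡ t
  unique-var uc s∈ t∈ with AllPairs-∈ (AllPairs.map⁻ uc) s∈ t∈
  ... | inj₁ refl       = refl
  ... | inj₂ (inj₁ v≢v) = contradiction refl v≢v
  ... | inj₂ (inj₂ v≢v) = contradiction refl v≢v

  falsify-∈ : ∀ {c} → Unique (vars c) → ∀ {l} → l ∈ c → False (falsify c) l
  falsify-∈ {c} uc {v , s} l∈ with (v , Sign.+) ∈ˡ? c
  falsify-∈ {c} uc {v , Sign.+} l∈ | yes _  = refl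
  falsify-∈ {c} uc {v , Sign.+} l∈ | no +∉  = contradiction l∈ +∉
  falsify-∈ {c} uc {v , Sign.-} l∈ | yes +∈ with () ← unique-var uc +∈ l∈
  falsify-∈ {c} uc {v , Sign.-} l∈ | no +∉  = refl

  ∈-falsify : ∀ {c l} → proj₁ l ∈ vars c → False (falsify c) l → l ∈ c
  ∈-falsify {c} {v , s} v∈ f with (v , Sign.+) ∈ˡ? c
  ∈-falsify {c} {v , Sign.+} v∈ f  | yes +∈ = +∈
  ∈-falsify {c} {v , Sign.-} v∈ () | yes +∈
  ∈-falsify {c} {v , Sign.+} v∈ () | no +∉
  ∈-falsify {c} {v , Sign.-} v∈ f  | no +∉ with ∈-map⁻ proj₁ v∈
  ... | (_ , Sign.+) , l∈ , refl = contradiction l∈ +∉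
  ... | (_ , Sign.-) , l∈ , refl = l∈

  infix 4 _≈_ _≈?_
  -- For monomials without repeated variables: equality up to sign and order of the factors, so that
  -- exactly such monomials can merge or cancel.
  _≈_ : List (Literal {k}) → List (Literal {k}) → Set
  S ≈ T = vars S ⊆ vars T × vars T ⊆ vars S

  _≈?_ : ∀ S T → Dec (S ≈ T)
  S ≈? T = (vars S ⊆? vars T) ×-dec (vars T ⊆? vars S)

  module _ (L : List (List (Literal {k})))
           (three  : ∀ {c} → c ∈ L → length c ≡ 3)
           (unique : ∀ {c} → c ∈ L → Unique (vars c))
           (twice  : ∀ l → length (filter (l ≟ˡ_) (concat L)) ℕ.≤ 2) where

    -- The non-constant part of eight times the number of unsatisfied clauses; the constant part is
    -- `length L`.
    terms : List (List (Literal {k}))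
    terms = concatMap expand L

    ∈-terms⁻ : ∀ {S} → S ∈ terms → ∃ λ c → c ∈ L × S ∈ expand c
    ∈-terms⁻ S∈ with ∈-concat⁻′ (map expand L) S∈
    ... | _ , S∈c , c∈ with ∈-map⁻ expand c∈
    ... | c , c∈L , refl = c , c∈L , S∈c

    terms-unique : ∀ {S} → S ∈ terms → Unique (vars S)
    terms-unique S∈ with ∈-terms⁻ S∈
    ... | c , c∈ , S∈c = AllPairs.map⁺ (proj₁ (expand-AllPairs (AllPairs.map⁻ (unique c∈)) S∈c))

    terms-⊆ : ∀ {S} → S ∈ terms → ∃ λ c → c ∈ L × S ⊆ c
    terms-⊆ S∈ with ∈-terms⁻ S∈
    ... | c , c∈ , S∈c = c , c∈ , proj₂ (expand-AllPairs (AllPairs.map⁻ (unique c∈)) S∈c)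

    terms-length : ∀ {S} → S ∈ terms → length S ℕ.≤ 3
    terms-length {S} S∈ with terms-⊆ S∈
    ... | c , c∈ , S⊆c = begin
      length S  ≤⟨ unique-⊆-length (AllPairs.map (λ v≢ eq → v≢ (cong proj₁ eq)) (AllPairs.map⁻ (terms-unique S∈))) S⊆c ⟩
      length c  ≡⟨ three c∈ ⟩
      3         ∎
      where open ℕ.≤-Reasoning

    module _ {c} (c∈ : c ∈ L) where

      private
        x = falsify c

        Small : Pred (List (Literal {k})) 0ℓ
        Small S = 2 ℕ.≤ length S × vars S ⊆ vars c

        small? : Decidable Small
        small? S = big? S ×-dec within? (vars c) S

        hits : List (Literal {k}) → ℤ
        hits d = + length (filter (_∈ˡ? c) d)

        filter-small : ∀ d → filter small? (expand d) ≡ filter big? (expand (restrict (vars c) d))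
        filter-small d = begin
          filter small? (expand d)                                  ≡⟨ filter-filter small? (within? (vars c)) (expand d) (λ _ → proj₂) ⟨
          filter small? (filter (within? (vars c)) (expand d))      ≡⟨ filter-cong small? big? _ (λ _ → proj₁) (λ {S} S∈ b → b , proj₂ (∈-filter⁻ (within? (vars c)) {xs = expand d} S∈)) ⟩
          filter big? (filter (within? (vars c)) (expand d))        ≡⟨ cong (filter big?) (filter-within (vars c) d) ⟩
          filter big? (expand (restrict (vars c) d))                ∎
          where open ≡-Reasoning

        -- On a variable of `c`, the assignment `falsify c` makes only the literal of `c` false, so
        -- each false literal of the restricted clause is a hit.
        #false≤hits : ∀ d → #false x (restrict (vars c) d) ℤ.≤ hits d
        #false≤hits []      = ℤ.≤-refl
        #false≤hits (l ∷ d) = go (proj₁ l ∈? vars c)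
          where
          weaken : hits d ℤ.≤ hits (l ∷ d)
          weaken with l ∈ˡ? c
          ... | yes _ = ℤ.+≤+ (ℕ.n≤1+n _)
          ... | no  _ = ℤ.≤-refl
          go : Dec (proj₁ l ∈ vars c) → #false x (restrict (vars c) (l ∷ d)) ℤ.≤ hits (l ∷ d)
          go (no l∉)  = subst (λ r → #false x r ℤ.≤ hits (l ∷ d)) (sym (List.filter-reject (λ l → proj₁ l ∈? vars c) l∉))
                          (ℤ.≤-trans (#false≤hits d) weaken)
          go (yes l∈) = subst (λ r → #false x r ℤ.≤ hits (l ∷ d)) (sym (List.filter-accept (λ l → proj₁ l ∈? vars c) l∈)) go′
            where
            go′ : #false x (l ∷ restrict (vars c) d) ℤ.≤ hits (l ∷ d)
            go′ with false? x l
            ... | no _ = ℤ.≤-trans (#false≤hits d) weaken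
            ... | yes f = subst (λ r → 1ℤ ℤ.+ #false x (restrict (vars c) d) ℤ.≤ + length r)
                            (sym (List.filter-accept (_∈ˡ? c) (∈-falsify l∈ f)))
                            (ℤ.+-monoʳ-≤ 1ℤ (#false≤hits d))

        -- The hits compensate for negative monomials: by `big-bound` no clause has a negative gain.
        gain : List (Literal {k}) → ℤ
        gain d = eval x (filter small? (expand d)) ℤ.+ hits d

        gain-nonneg : ∀ d → 0ℤ ℤ.≤ gain d
        gain-nonneg d = begin
          0ℤ                                                                                    ≤⟨ proj₁ (big-bound x (restrict (vars c) d)) ⟩
          eval x (filter big? (expand (restrict (vars c) d))) ℤ.+ #false x (restrict (vars c) d) ≡⟨ cong (λ Ts → eval x Ts ℤ.+ #false x (restrict (vars c) d)) (filter-small d) ⟨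
          eval x (filter small? (expand d)) ℤ.+ #false x (restrict (vars c) d)                  ≤⟨ ℤ.+-monoʳ-≤ (eval x (filter small? (expand d))) (#false≤hits d) ⟩
          gain d                                                                                ∎
          where open ℤ.≤-Reasoning

        -- At `falsify c` the three pairs and the triple of literals of `c` all have value 1, and
        -- all three literals are hits.
        gain-c : gain c ≡ + 7
        gain-c = cong₂ ℤ._+_ (≡-trans (cong (eval x) (≡-trans (filter-small c) (cong (filter big? ∘ expand) (List.filter-all (λ l → proj₁ l ∈? vars c) (All.tabulate (∈-map⁺ proj₁))))))
                                (four c (three c∈) (falsify-∈ (unique c∈))))
                             (cong +_ (≡-trans (cong length (List.filter-all (_∈ˡ? c) (All.tabulate id))) (three c∈)))
          where
          four : ∀ d → length d ≡ 3 → (∀ {l} → l ∈ d → False x l) → eval x (filter big? (expand d)) ≡ + 4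
          four (l₁ ∷ l₂ ∷ l₃ ∷ []) refl f
            rewrite f (here refl) | f (there (here refl)) | f (there (there (here refl))) = refl

        -- Each of the three literals of `c` occurs at most twice in the formula.
        ∑hits≤6 : ∑ hits L ℤ.≤ + 6
        ∑hits≤6 = begin
          ∑ hits L                                  ≡⟨ ∑-length-filter (_∈ˡ? c) L ⟩
          + length (filter (_∈ˡ? c) (concat L))     ≤⟨ ℤ.+≤+ (length-≤-cover _≟ˡ_ 2 c (filter (_∈ˡ? c) (concat L))
                                                        (λ l∈ → Any.map sym (proj₂ (∈-filter⁻ (_∈ˡ? c) {xs = concat L} l∈)))
                                                        (λ {l} l∈ → ℕ.≤-trans (ℕ.≤-reflexive (cong length
                                                          (filter-filter (l ≟ˡ_) (_∈ˡ? c) (concat L) (λ { _ refl → l∈ })))) (twice l))) ⟩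
          + (length c ℕ.* 2)                        ≡⟨ cong (λ m → + (m ℕ.* 2)) (three c∈) ⟩
          + 6                                       ∎
          where open ℤ.≤-Reasoning

        -- The clause c contributes 4 + 3 = 7 to ∑ gain, of which at most 6 are hits.
        small-positive : 1ℤ ℤ.≤ eval x (filter small? terms)
        small-positive = begin
          + 7 ℤ.- + 6                                            ≤⟨ ℤ.+-monoˡ-≤ (ℤ.- + 6) 7≤ ⟩
          (eval x (filter small? terms) ℤ.+ + 6) ℤ.- + 6         ≡⟨ cancel (eval x (filter small? terms)) (+ 6) ⟩
          eval x (filter small? terms)                           ∎
          where
          open ℤ.≤-Reasoning
          cancel : ∀ a b → (a ℤ.+ b) ℤ.- b ≡ a
          cancel = solve-∀
          smalls : List (Literal {k}) → List (List (Literal {k}))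
          smalls = filter small? ∘ expand
          7≤ : + 7 ℤ.≤ eval x (filter small? terms) ℤ.+ + 6
          7≤ = begin
            + 7                                                  ≡⟨ gain-c ⟨
            gain c                                               ≤⟨ ≤-∑ c∈ (λ {d} _ → gain-nonneg d) ⟩
            ∑ gain L                                             ≡⟨ ∑-+ (eval x ∘ smalls) hits L ⟩
            ∑ (eval x ∘ smalls) L ℤ.+ ∑ hits L                   ≤⟨ ℤ.+-monoʳ-≤ (∑ (eval x ∘ smalls) L) ∑hits≤6 ⟩
            ∑ (eval x ∘ smalls) L ℤ.+ + 6                        ≡⟨ cong (ℤ._+ + 6) (∑-concatMap (⟦_⟧ ∘ val x) smalls L) ⟨
            eval x (concatMap smalls L) ℤ.+ + 6                  ≡⟨ cong (λ Ts → eval x Ts ℤ.+ + 6) (filter-concatMap small? expand L) ⟨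
            eval x (filter small? terms) ℤ.+ + 6                 ∎

      abstract
        -- The positive sum of `small-positive` splits into classes of `_≈_`, one of which is
        -- positive. Being `Small` depends only on the set of variables, so this class is a whole
        -- class of `terms`.
        active : ∃ λ S → S ∈ terms × 2 ℕ.≤ length S × vars S ⊆ vars c × 1ℤ ℤ.≤ eval x (filter (S ≈?_) terms)
        active with positive-class _≈?_ (λ (a⊆c , c⊆a) (b⊆c , c⊆b) → c⊆b ∘ a⊆c , c⊆a ∘ b⊆c) (id , id)
                      (⟦_⟧ ∘ val x) (filter small? terms) small-positive
        ... | S , S∈ , pos with ∈-filter⁻ small? {xs = terms} S∈
        ... | S∈terms , 2≤ , S⊆ = S , S∈terms , 2≤ , S⊆ ,
          subst (λ Ts → 1ℤ ℤ.≤ eval x Ts) (filter-filter (S ≈?_) small? terms small) pos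
          where
          small : ∀ {T} → T ∈ terms → S ≈ T → Small T
          small {T} T∈ (S⊆T , T⊆S) = (begin
            2               ≤⟨ 2≤ ⟩
            length S        ≡⟨ vars-length S ⟨
            length (vars S) ≤⟨ unique-⊆-length (terms-unique S∈terms) S⊆T ⟩
            length (vars T) ≡⟨ vars-length T ⟩
            length T        ∎) , S⊆ ∘ T⊆S
            where open ℕ.≤-Reasoning

-- Disjoint active terms and the total gain

AllPairs-map∈ : ∀ {A : Set} {R S : A → A → Set} {xs} → (∀ {x y} → x ∈ xs → y ∈ xs → R x y → S x y) →
                AllPairs R xs → AllPairs S xs
AllPairs-map∈ f []       = []
AllPairs-map∈ f (r ∷ rs) = All.tabulate (λ y∈ → f (here refl) (there y∈) (All.lookup r y∈)) ∷
                           AllPairs-map∈ (λ x∈ y∈ → f (there x∈) (there y∈)) rs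

length-concatMap : ∀ {A B : Set} (f : A → List B) m xs → (∀ {x} → x ∈ xs → length (f x) ≡ m) →
                   length (concatMap f xs) ≡ length xs ℕ.* m
length-concatMap f m []       f≡m = refl
length-concatMap f m (x ∷ xs) f≡m =
  ≡-trans (List.length-++ (f x)) (cong₂ ℕ._+_ (f≡m (here refl)) (length-concatMap f m xs (f≡m ∘ there)))

multiple-nonzero : ∀ m {a b} → 1ℤ ℤ.≤ b → b ≡ m ℤ.* a → a ≢ 0ℤ
multiple-nonzero m 1≤b refl refl with subst (1ℤ ℤ.≤_) (ℤ.*-zeroʳ m) 1≤b
... | ℤ.+≤+ ()

module _ {k : ℕ} where
  open import Data.List.Membership.DecPropositional (Fin._≟_ {k}) using (_∈?_)
  open import Data.List.Membership.DecPropositional (_≟ˡ_ {k}) using () renaming (_∈?_ to _∈ˡ?_)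

  -- The sign of each literal enters twice and cancels, so only the variables matter for how the
  -- value of a monomial changes between two assignments.
  val-val : ∀ y x (S : List (Literal {k})) → val y S Sign.* val x S ≡ χ (y · x) (vars S)
  val-val y x []            = refl
  val-val y x ((v , s) ∷ S) = begin
    (falsity y (v , s) Sign.* val y S) Sign.* (falsity x (v , s) Sign.* val x S)
      ≡⟨ Sign*.interchange (falsity y (v , s)) (val y S) (falsity x (v , s)) (val x S) ⟩
    (falsity y (v , s) Sign.* falsity x (v , s)) Sign.* (val y S Sign.* val x S)
      ≡⟨ cong₂ Sign._*_ (opposites s (y v) (x v)) (val-val y x S) ⟩
    χ (y · x) (v ∷ vars S) ∎
    where
    open ≡-Reasoning
    opposites : ∀ s t u → opposite (s Sign.* t) Sign.* opposite (s Sign.* u) ≡ t Sign.* u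
    opposites Sign.+ Sign.+ Sign.+ = refl
    opposites Sign.+ Sign.+ Sign.- = refl
    opposites Sign.+ Sign.- Sign.+ = refl
    opposites Sign.+ Sign.- Sign.- = refl
    opposites Sign.- Sign.+ Sign.+ = refl
    opposites Sign.- Sign.+ Sign.- = refl
    opposites Sign.- Sign.- Sign.+ = refl
    opposites Sign.- Sign.- Sign.- = refl

  -- Applied to a class of `_≈_`, all of whose monomials change by the same factor between two
  -- assignments: the value of the class is the same everywhere up to sign.
  eval-scale : ∀ {s} y x (Ts : List (List (Literal {k}))) → (∀ {T} → T ∈ Ts → χ (y · x) (vars T) ≡ s) →
               eval x Ts ≡ ⟦ s ⟧ ℤ.* eval y Ts
  eval-scale {s} y x []       χ≡s = sym (ℤ.*-zeroʳ ⟦ s ⟧)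
  eval-scale {s} y x (T ∷ Ts) χ≡s = begin
    ⟦ val x T ⟧ ℤ.+ eval x Ts                        ≡⟨ cong₂ ℤ._+_ (cong ⟦_⟧ val≡) (eval-scale y x Ts (χ≡s ∘ there)) ⟩
    ⟦ s Sign.* val y T ⟧ ℤ.+ ⟦ s ⟧ ℤ.* eval y Ts     ≡⟨ cong (ℤ._+ ⟦ s ⟧ ℤ.* eval y Ts) (⟦⟧-* s (val y T)) ⟩
    ⟦ s ⟧ ℤ.* ⟦ val y T ⟧ ℤ.+ ⟦ s ⟧ ℤ.* eval y Ts    ≡⟨ ℤ.*-distribˡ-+ ⟦ s ⟧ _ _ ⟨
    ⟦ s ⟧ ℤ.* eval y (T ∷ Ts)                        ∎
    where
    open ≡-Reasoning
    val≡ : val x T ≡ s Sign.* val y T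
    val≡ = Sign.*-cancelˡ-≡ (val y T) (val x T) (s Sign.* val y T) (begin
      val y T Sign.* val x T               ≡⟨ val-val y x T ⟩
      χ (y · x) (vars T)                   ≡⟨ χ≡s (here refl) ⟩
      s                                    ≡⟨ Sign.*-identityʳ s ⟨
      s Sign.* Sign.+                      ≡⟨ cong (s Sign.*_) (Sign.s*s≡+ (val y T)) ⟨
      s Sign.* (val y T Sign.* val y T)    ≡⟨ Sign.*-assoc s (val y T) (val y T) ⟨
      (s Sign.* val y T) Sign.* val y T    ≡⟨ Sign.*-comm (s Sign.* val y T) (val y T) ⟩
      val y T Sign.* (s Sign.* val y T)    ∎)

  single : Fin k → Assignment {k}
  single v w with v Fin.≟ w
  ... | yes _ = Sign.-
  ... | no  _ = Sign.+

  χ-single-∉ : ∀ {v vs} → v ∉ vs → χ (single v) vs ≡ Sign.+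
  χ-single-∉ {v} {[]}     v∉ = refl
  χ-single-∉ {v} {w ∷ vs} v∉ with v Fin.≟ w
  ... | yes eq = contradiction (here eq) v∉
  ... | no  _  = χ-single-∉ (v∉ ∘ there)

  χ-single-∈ : ∀ {v vs} → Unique vs → v ∈ vs → χ (single v) vs ≡ Sign.-
  χ-single-∈ {v} {w ∷ vs} (w∉ ∷ uvs) v∈ with v Fin.≟ w
  χ-single-∈ {v} {w ∷ vs} (w∉ ∷ uvs) v∈         | yes refl = cong opposite (χ-single-∉ λ v∈vs → All.lookup w∉ v∈vs refl)
  χ-single-∈ {v} {w ∷ vs} (w∉ ∷ uvs) (here eq)  | no ¬eq   = contradiction eq ¬eq
  χ-single-∈ {v} {w ∷ vs} (w∉ ∷ uvs) (there v∈) | no ¬eq   = χ-single-∈ uvs v∈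

  -- Flips the first variable. The trivial flip for the empty list is a default; active terms have
  -- at least two literals.
  lead : List (Literal {k}) → Assignment {k}
  lead []      = λ _ → Sign.+
  lead (l ∷ _) = single (proj₁ l)

  Meets : List (Literal {k}) → List (Literal {k}) → Set
  Meets d c = Any (λ l → proj₁ l ∈ vars c) d

  meets? : ∀ d c → Dec (Meets d c)
  meets? d c = Any.any? (λ l → proj₁ l ∈? vars c) d

  Disjoint-vars : List (Literal {k}) → List (Literal {k}) → Set
  Disjoint-vars S T = ∀ v → v ∈ vars S → v ∉ vars T

  Unsatisfied : Assignment {k} → Pred (List (Literal {k})) 0ℓ
  Unsatisfied x = All (False x)

  unsatisfied? : ∀ x → Decidable (Unsatisfied x)
  unsatisfied? x = All.all? (false? x)

  -- Flips of one or two variables suffice: a single flip removes monomials with a variable outside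
  -- the family, and a double flip within a member `T` removes those that contain just one of the
  -- two variables.
  candidates : List (Assignment {k})
  candidates = map single (allFin k) ++ concatMap (λ v → map (λ w → single v · single w) (allFin k)) (allFin k)

  single∈candidates : ∀ v → single v ∈ candidates
  single∈candidates v = ∈-++⁺ˡ (∈-map⁺ single (∈-allFin v))

  pair∈candidates : ∀ v w → single v · single w ∈ candidates
  pair∈candidates v w = ∈-++⁺ʳ (map single (allFin k))
    (∈-concat⁺′ (∈-map⁺ (λ w → single v · single w) (∈-allFin w)) (∈-map⁺ (λ v → map (λ w → single v · single w) (allFin k)) (∈-allFin v)))

  module _ (L : List (List (Literal {k})))
           (three  : ∀ {c} → c ∈ L → length c ≡ 3)
           (unique : ∀ {c} → c ∈ L → Unique (vars c))
           (twice  : ∀ l → length (filter (l ≟ˡ_) (concat L)) ℕ.≤ 2) where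

    private
      terms′ = terms L three unique twice
      uniqueᵗ : ∀ {S} → S ∈ terms′ → Unique (vars S)
      uniqueᵗ = terms-unique L three unique twice

    Active : Pred (List (Literal {k})) 0ℓ
    Active S = S ∈ terms′ × 2 ℕ.≤ length S × ∀ y → eval y (filter (S ≈?_) terms′) ≢ 0ℤ

    χ-≈ : ∀ g {S T} → S ∈ terms′ → T ∈ terms′ → S ≈ T → χ g (vars S) ≡ χ g (vars T)
    χ-≈ g S∈ T∈ (S⊆T , T⊆S) = χ-↭ g (unique-↭ (uniqueᵗ S∈) (uniqueᵗ T∈) S⊆T T⊆S)

    -- The class found by `active` is positive at `falsify c`. At any other assignment its value
    -- differs at most in sign, so it vanishes nowhere.
    active-within : ∀ {c} → c ∈ L → ∃ λ S → Active S × vars S ⊆ vars c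
    active-within {c} c∈ = activate (active L three unique twice c∈)
      where
      activate : (∃ λ S → S ∈ terms′ × 2 ℕ.≤ length S × vars S ⊆ vars c × 1ℤ ℤ.≤ eval (falsify c) (filter (S ≈?_) terms′)) →
                 ∃ λ S → Active S × vars S ⊆ vars c
      activate (S , S∈ , 2≤ , S⊆ , pos) = S , (S∈ , 2≤ , nonzero) , S⊆
        where
        same : ∀ y {T} → T ∈ filter (S ≈?_) terms′ → χ (y · falsify c) (vars T) ≡ χ (y · falsify c) (vars S)
        same y T∈ = sym (χ-≈ (y · falsify c) S∈ (proj₁ (∈-filter⁻ (S ≈?_) {xs = terms′} T∈)) (proj₂ (∈-filter⁻ (S ≈?_) {xs = terms′} T∈)))
        nonzero : ∀ y → eval y (filter (S ≈?_) terms′) ≢ 0ℤ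
        nonzero y = multiple-nonzero ⟦ χ (y · falsify c) (vars S) ⟧ pos (eval-scale y (falsify c) (filter (S ≈?_) terms′) (same y))

    -- Terms inside clauses without common variables have no common variables. The last component
    -- records the clause around each term, from which the induction derives disjointness.
    disjoint-actives : ∀ cs → cs ⊆ L → AllPairs (λ d c → ¬ Meets d c) cs →
      ∃ λ Ss → length Ss ≡ length cs × All Active Ss × AllPairs Disjoint-vars Ss ×
               All (λ S → ∃ λ c → c ∈ cs × vars S ⊆ vars c) Ss
    disjoint-actives []       cs⊆L []       = [] , refl , [] , [] , []
    disjoint-actives (c ∷ cs) cs⊆L (m ∷ ms)
      with active-within (cs⊆L (here refl)) | disjoint-actives cs (cs⊆L ∘ there) ms
    ... | S , act , S⊆c | Ss , len , acts , disj , origins =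
      S ∷ Ss , cong ℕ.suc len , act ∷ acts ,
      All.map (λ (c′ , c′∈ , T⊆c′) v v∈S v∈T → All.lookup m c′∈ (meet (S⊆c v∈S) (T⊆c′ v∈T))) origins ∷ disj ,
      (c , here refl , S⊆c) ∷ All.map widen origins
      where
      widen : ∀ {T} → (∃ λ d → d ∈ cs × vars T ⊆ vars d) → ∃ λ d → d ∈ c ∷ cs × vars T ⊆ vars d
      widen (d , d∈ , T⊆d) = d , there d∈ , T⊆d
      meet : ∀ {c′ v} → v ∈ vars c → v ∈ vars c′ → Meets c c′
      meet v∈c v∈c′ with ∈-map⁻ proj₁ v∈c
      ... | l , l∈ , refl = Any.map (λ { refl → v∈c′ }) l∈

    module _ {Ss : List (List (Literal {k}))} (acts : All Active Ss) (disj : AllPairs Disjoint-vars Ss) where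

      private
        flips : List (Assignment {k})
        flips = filter (λ g → All.all? (even? g) Ss) candidates

        survivors = kill flips terms′

        in-terms : ∀ {S} → S ∈ Ss → S ∈ terms′
        in-terms = proj₁ ∘ All.lookup acts

        same-or-disjoint : ∀ {S T} → S ∈ Ss → T ∈ Ss → S ≡ T ⊎ Disjoint-vars S T
        same-or-disjoint S∈ T∈ with AllPairs-∈ disj S∈ T∈
        ... | inj₁ eq        = inj₁ eq
        ... | inj₂ (inj₁ dj) = inj₂ dj
        ... | inj₂ (inj₂ dj) = inj₂ (λ v v∈S v∈T → dj v v∈T v∈S)

        even-survivor : ∀ {S g} → S ∈ survivors → g ∈ candidates → (∀ {T} → T ∈ Ss → Even g T) → Even g S
        even-survivor S∈ g∈ ev = All.lookup (proj₂ (∈-kill⁻ flips S∈)) (∈-filter⁺ (λ g → All.all? (even? g) Ss) g∈ (All.tabulate ev))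

        survivor-in-terms : ∀ {S} → S ∈ survivors → S ∈ terms′
        survivor-in-terms = proj₁ ∘ ∈-kill⁻ flips

        -- If `v` lay in no member of the family, the flip of `v` alone would be among `flips` and
        -- would have removed `S`.
        covered : ∀ {S v} → S ∈ survivors → v ∈ vars S → Any (λ T → v ∈ vars T) Ss
        covered {S} {v} S∈ v∈ with Any.any? (λ T → v ∈? vars T) Ss
        ... | yes c = c
        ... | no ¬c with () ← ≡-trans (sym (χ-single-∈ (uniqueᵗ (survivor-in-terms S∈)) v∈))
                            (even-survivor S∈ (single∈candidates v) λ T∈ → χ-single-∉ (All.lookup (All.¬Any⇒All¬ Ss ¬c) T∈))

        -- If `w` were missing from `S`, flipping `v` and `w` would change `S`. Yet it leaves all
        -- members of the family even: `T` contains both variables and the others neither.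
        closed : ∀ {S T v} → S ∈ survivors → T ∈ Ss → v ∈ vars S → v ∈ vars T → vars T ⊆ vars S
        closed {S} {T} {v} S∈ T∈ v∈S v∈T {w} w∈T with w ∈? vars S
        ... | yes w∈S = w∈S
        ... | no  w∉S = contradiction (≡-trans (sym χ≡-) (even-survivor S∈ (pair∈candidates v w) ev)) λ ()
          where
          χ≡- : χ (single v · single w) (vars S) ≡ Sign.-
          χ≡- = ≡-trans (χ-· (single v) (single w) (vars S))
                  (cong₂ Sign._*_ (χ-single-∈ (uniqueᵗ (survivor-in-terms S∈)) v∈S) (χ-single-∉ w∉S))
          ev : ∀ {T′} → T′ ∈ Ss → Even (single v · single w) T′
          ev {T′} T′∈ with same-or-disjoint T∈ T′∈
          ... | inj₁ refl = ≡-trans (χ-· (single v) (single w) (vars T))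
                              (cong₂ Sign._*_ (χ-single-∈ (uniqueᵗ (in-terms T∈)) v∈T) (χ-single-∈ (uniqueᵗ (in-terms T∈)) w∈T))
          ... | inj₂ dj   = ≡-trans (χ-· (single v) (single w) (vars T′))
                              (cong₂ Sign._*_ (χ-single-∉ (dj v v∈T)) (χ-single-∉ (dj w w∈T)))

        -- By `closed`, `S` contains every member of the family that it meets. Two disjoint members
        -- would need at least four variables, but a term has at most three; so `S` meets only `T`,
        -- and `covered` puts all its variables there.
        survivor-≈ : ∀ {S T v} → S ∈ survivors → T ∈ Ss → v ∈ vars S → v ∈ vars T → T ≈ S
        survivor-≈ {S} {T} S∈ T∈ v∈S v∈T = T⊆S , S⊆T
          where
          T⊆S = closed S∈ T∈ v∈S v∈T
          S⊆T : vars S ⊆ vars T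
          S⊆T {u} u∈S with find (covered S∈ u∈S)
          ... | T′ , T′∈ , u∈T′ with same-or-disjoint T∈ T′∈
          ... | inj₁ refl = u∈T′
          ... | inj₂ dj   = contradiction (ℕ.≤-trans four≤ three≥) λ { (ℕ.s≤s (ℕ.s≤s (ℕ.s≤s ()))) }
            where
            open ℕ.≤-Reasoning
            four≤ : 4 ℕ.≤ length (vars S)
            four≤ = begin
              4                                  ≤⟨ ℕ.+-mono-≤ (proj₁ (proj₂ (All.lookup acts T∈))) (proj₁ (proj₂ (All.lookup acts T′∈))) ⟩
              length T ℕ.+ length T′             ≡⟨ cong₂ ℕ._+_ (vars-length T) (vars-length T′) ⟨
              length (vars T) ℕ.+ length (vars T′) ≡⟨ List.length-++ (vars T) ⟨
              length (vars T ++ vars T′)         ≤⟨ unique-⊆-length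
                                                      (Unique.++⁺ (uniqueᵗ (in-terms T∈)) (uniqueᵗ (in-terms T′∈)) (λ {u} (u∈T , u∈T′) → dj u u∈T u∈T′))
                                                      (λ v∈ → [ T⊆S , closed S∈ T′∈ u∈S u∈T′ ]′ (∈-++⁻ (vars T) v∈)) ⟩
              length (vars S)                    ∎
            three≥ : length (vars S) ℕ.≤ 3
            three≥ = ℕ.≤-trans (ℕ.≤-reflexive (vars-length S)) (terms-length L three unique twice (survivor-in-terms S∈))

        lead-var : ∀ {T} → T ∈ Ss → ∃ λ v → v ∈ vars T × lead T ≡ single v
        lead-var {T} T∈ with T | proj₁ (proj₂ (All.lookup acts T∈))
        ... | l ∷ _ | _ = proj₁ l , here refl , refl

        odd-lead⇒≈ : ∀ {S T} → S ∈ survivors → T ∈ Ss → ¬ Even (lead T) S → T ≈ S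
        odd-lead⇒≈ {S} {T} S∈ T∈ odd with lead-var T∈
        ... | v , v∈T , eq rewrite eq with v ∈? vars S
        ... | yes v∈S = survivor-≈ S∈ T∈ v∈S v∈T
        ... | no  v∉S = contradiction (χ-single-∉ v∉S) odd

        ≈⇒odd-lead : ∀ {S T} → S ∈ survivors → T ∈ Ss → T ≈ S → ¬ Even (lead T) S
        ≈⇒odd-lead {S} {T} S∈ T∈ (T⊆S , _) ev with lead-var T∈
        ... | v , v∈T , eq rewrite eq with () ← ≡-trans (sym (χ-single-∈ (uniqueᵗ (survivor-in-terms S∈)) (T⊆S v∈T))) ev

        -- Survivors that contain the first variable of `T` are exactly those on the variables of
        -- `T`, and `flips`, being even on `T`, removed none of that class. Hence the odd part is
        -- the one that `Active` declares non-zero.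
        odds-lead : ∀ {T} → T ∈ Ss → odds (lead T) survivors ≡ filter (T ≈?_) terms′
        odds-lead {T} T∈ = ≡-trans
          (filter-cong (¬? ∘ even? (lead T)) (T ≈?_) survivors (λ S∈ → odd-lead⇒≈ S∈ T∈) (λ S∈ → ≈⇒odd-lead S∈ T∈))
          (filter-kill (T ≈?_) flips terms′ λ S∈ T≈S → All.tabulate λ {g} g∈ →
            ≡-trans (sym (χ-≈ g (in-terms T∈) S∈ T≈S))
                    (All.lookup (proj₂ (∈-filter⁻ (λ g → All.all? (even? g) Ss) {xs = candidates} g∈)) T∈))

        -- A survivor that is odd under the lead of `U` has the variables of `U` and so avoids those
        -- of `T`.
        leads-independent : ∀ {T U} → T ∈ Ss → U ∈ Ss → Disjoint-vars T U → ∀ S → S ∈ survivors → ¬ Even (lead U) S → Even (lead T) S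
        leads-independent T∈ U∈ dj S S∈ odd with lead-var T∈
        ... | v , v∈T , eq rewrite eq = χ-single-∉ λ v∈S → dj v v∈T (proj₂ (odd-lead⇒≈ S∈ U∈ odd) v∈S)

        -- Any variable of a survivor lies in some `T` of the family; the survivor then has the
        -- variables of `T` and is removed by the lead of `T`.
        no-survivor : ∀ {S} → S ∉ kill (map lead Ss) survivors
        no-survivor {S} S∈kill with ∈-kill⁻ (map lead Ss) S∈kill
        ... | S∈ , evens with ∈-terms⁻ L three unique twice (survivor-in-terms S∈)
        ... | c , _ , S∈c with S | expand-nonempty c S∈c
        ... | l ∷ _ | _ with find (covered S∈ (here refl))
        ... | T , T∈ , v∈T = ≈⇒odd-lead S∈ T∈ (survivor-≈ S∈ T∈ (here refl) v∈T) (All.lookup evens (∈-map⁺ lead T∈))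

        no-survivors : kill (map lead Ss) survivors ≡ []
        no-survivors = empty (kill (map lead Ss) survivors) no-survivor
          where
          empty : ∀ xs → (∀ {S} → S ∉ xs) → xs ≡ []
          empty []      ∉ = refl
          empty (S ∷ _) ∉ = contradiction (here refl) ∉

      total-gain : ∃ λ x → eval x terms′ ℤ.+ + length Ss ℤ.≤ 0ℤ
      -- The starting assignment is arbitrary, because no monomial is left at the end.
      total-gain with kill-gain (map lead Ss) survivors (λ _ → Sign.+)
                        (All.map⁺ (All.tabulate λ T∈ y → proj₂ (proj₂ (All.lookup acts T∈)) y ∘ ≡-trans (cong (eval y) (sym (odds-lead T∈)))))
                        (AllPairs.map⁺ (AllPairs-map∈ leads-independent disj))
      ... | y , y≤ with kill-≤ flips terms′ y
      ... | x , x≤ = x , (begin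
        eval x terms′ ℤ.+ + length Ss                    ≤⟨ ℤ.+-monoˡ-≤ (+ length Ss) x≤ ⟩
        eval y survivors ℤ.+ + length Ss                 ≡⟨ cong (λ m → eval y survivors ℤ.+ + m) (List.length-map lead Ss) ⟨
        eval y survivors ℤ.+ + length (map lead Ss)      ≤⟨ y≤ ⟩
        eval (λ _ → Sign.+) (kill (map lead Ss) survivors) ≡⟨ cong (eval (λ _ → Sign.+)) no-survivors ⟩
        0ℤ                                               ∎)
        where open ℤ.≤-Reasoning

-- Few unsatisfied clauses in a 3-CNF whose literals occur at most twice

module _ {k : ℕ} where
  open import Data.List.Membership.DecPropositional (Fin._≟_ {k}) using (_∈?_)
  open import Data.List.Membership.DecPropositional (_≟ˡ_ {k}) using () renaming (_∈?_ to _∈ˡ?_)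

  ∑-∏ : ∀ x (L : List (List (Literal {k}))) → ∑ (∏ x) L ≡ + length L ℤ.+ eval x (concatMap expand L)
  ∑-∏ x []      = refl
  ∑-∏ x (c ∷ L) = begin
    ∏ x c ℤ.+ ∑ (∏ x) L
      ≡⟨ cong₂ ℤ._+_ (∏-expand x c) (∑-∏ x L) ⟩
    (1ℤ ℤ.+ eval x (expand c)) ℤ.+ (+ length L ℤ.+ eval x (concatMap expand L))
      ≡⟨ interchange (eval x (expand c)) (+ length L) (eval x (concatMap expand L)) ⟩
    (1ℤ ℤ.+ + length L) ℤ.+ (eval x (expand c) ℤ.+ eval x (concatMap expand L))
      ≡⟨ cong (ℤ._+_ (+ length (c ∷ L))) (eval-++ x (expand c) (concatMap expand L)) ⟨
    + length (c ∷ L) ℤ.+ eval x (expand c ++ concatMap expand L) ∎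
    where
    open ≡-Reasoning
    interchange : ∀ a b c → (1ℤ ℤ.+ a) ℤ.+ (b ℤ.+ c) ≡ (1ℤ ℤ.+ b) ℤ.+ (a ℤ.+ c)
    interchange = solve-∀

  -- Each unsatisfied clause contributes 8 to the sum, and the other clauses contribute nothing
  -- negative.
  unsatisfied-≤-∏ : ∀ x (L : List (List (Literal {k}))) → (∀ {c} → c ∈ L → length c ≡ 3) →
                    + (8 ℕ.* length (filter (unsatisfied? x) L)) ℤ.≤ ∑ (∏ x) L
  unsatisfied-≤-∏ x []      three = ℤ.≤-refl
  unsatisfied-≤-∏ x (c ∷ L) three with unsatisfied? x c
  ... | no _  = ℤ.≤-trans (unsatisfied-≤-∏ x L (three ∘ there))
                  (ℤ.≤-trans (ℤ.≤-reflexive (sym (ℤ.+-identityˡ _))) (ℤ.+-monoˡ-≤ _ (∏-nonneg x c)))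
  ... | yes u = begin
    + (8 ℕ.* ℕ.suc (length (filter (unsatisfied? x) L)))       ≡⟨ cong +_ (ℕ.*-suc 8 (length (filter (unsatisfied? x) L))) ⟩
    + 8 ℤ.+ + (8 ℕ.* length (filter (unsatisfied? x) L))       ≤⟨ ℤ.+-mono-≤ (ℤ.≤-reflexive (sym (eight c (three (here refl)) u))) (unsatisfied-≤-∏ x L (three ∘ there)) ⟩
    ∏ x c ℤ.+ ∑ (∏ x) L                                        ∎
    where
    open ℤ.≤-Reasoning
    eight : ∀ c → length c ≡ 3 → Unsatisfied x c → ∏ x c ≡ + 8
    eight (l₁ ∷ l₂ ∷ l₃ ∷ []) refl (f₁ ∷ f₂ ∷ f₃ ∷ []) rewrite f₁ | f₂ | f₃ = refl

  length-filter-∈ : ∀ l (L : List (List (Literal {k}))) →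
                    length (filter (l ∈ˡ?_) L) ℕ.≤ length (filter (l ≟ˡ_) (concat L))
  length-filter-∈ l []      = ℕ.z≤n
  length-filter-∈ l (c ∷ L) rewrite List.filter-++ (l ≟ˡ_) c (concat L) | List.length-++ (filter (l ≟ˡ_) c) {filter (l ≟ˡ_) (concat L)}
    with l ∈ˡ? c
  ... | yes l∈ = ℕ.+-mono-≤ (List.filter-some (l ≟ˡ_) l∈) (length-filter-∈ l L)
  ... | no  l∉ = ℕ.≤-trans (length-filter-∈ l L) (ℕ.m≤n+m _ _)

  literals : List (Fin k) → List (Literal {k})
  literals = concatMap (λ v → (v , Sign.+) ∷ (v , Sign.-) ∷ [])

  ∈-literals⁺ : ∀ {v vs} s → v ∈ vs → (v , s) ∈ literals vs
  ∈-literals⁺ Sign.+ (here refl) = here refl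
  ∈-literals⁺ Sign.- (here refl) = there (here refl)
  ∈-literals⁺ s      (there v∈)  = there (there (∈-literals⁺ s v∈))

  ∈-literals⁻ : ∀ {l vs} → l ∈ literals vs → proj₁ l ∈ vs
  ∈-literals⁻ {vs = v ∷ vs} (here refl)         = here refl
  ∈-literals⁻ {vs = v ∷ vs} (there (here refl)) = here refl
  ∈-literals⁻ {vs = v ∷ vs} (there (there l∈))  = there (∈-literals⁻ l∈)

  literals-unique : ∀ {vs} → Unique vs → Unique (literals vs)
  literals-unique {[]}     []         = []
  literals-unique {v ∷ vs} (v∉ ∷ uvs) = ((λ ()) ∷ other) ∷ other ∷ literals-unique uvs
    where
    other : ∀ {s} → All (λ l → (v , s) ≢ l) (literals vs)
    other = All.tabulate λ { l∈ refl → All.lookup v∉ (∈-literals⁻ {vs = vs} l∈) refl }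

  length-literals : ∀ vs → length (literals vs) ≡ length vs ℕ.* 2
  length-literals vs = length-concatMap (λ v → (v , Sign.+) ∷ (v , Sign.-) ∷ []) 2 vs (λ _ → refl)

  module _ (L : List (List (Literal {k})))
           (three  : ∀ {c} → c ∈ L → length c ≡ 3)
           (unique : ∀ {c} → c ∈ L → Unique (vars c))
           (twice  : ∀ l → length (filter (l ≟ˡ_) (concat L)) ℕ.≤ 2) where

    -- The three variables of a clause in `cs` have six literals, each of which lies in at most two
    -- clauses; every clause of `L` contains one of these literals for some member of `cs`.
    length-≤-dominating : ∀ cs → cs ⊆ L → (∀ {d} → d ∈ L → Any (Meets d) cs) → length L ℕ.≤ length cs ℕ.* 12
    length-≤-dominating cs cs⊆L dom = begin
      length L                                    ≤⟨ length-≤-cover _∈ˡ?_ 2 (concatMap (literals ∘ vars) cs) L covered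
                                                       (λ {l} _ → ℕ.≤-trans (length-filter-∈ l L) (twice l)) ⟩
      length (concatMap (literals ∘ vars) cs) ℕ.* 2   ≡⟨ cong (ℕ._* 2) (length-concatMap (literals ∘ vars) 6 cs six) ⟩
      length cs ℕ.* 6 ℕ.* 2                       ≡⟨ ℕ.*-assoc (length cs) 6 2 ⟩
      length cs ℕ.* 12                            ∎
      where
      open ℕ.≤-Reasoning
      six : ∀ {c} → c ∈ cs → length (literals (vars c)) ≡ 6
      six {c} c∈ = ≡-trans (length-literals (vars c)) (cong (ℕ._* 2) (≡-trans (List.length-map proj₁ c) (three (cs⊆L c∈))))
      covered : ∀ {d} → d ∈ L → Any (_∈ d) (concatMap (literals ∘ vars) cs)
      covered {d} d∈ = shared (find (dom d∈))
        where
        shared : (∃ λ c → c ∈ cs × Meets d c) → Any (_∈ d) (concatMap (literals ∘ vars) cs)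
        shared (c , c∈ , meets) with find meets
        ... | (v , s) , l∈d , v∈c = lose (∈-concat⁺′ (∈-literals⁺ s v∈c) (∈-map⁺ (literals ∘ vars) c∈)) l∈d

    -- With u unsatisfied clauses among N and a family of size k, `total-gain` gives 8u + k ≤ N.
    -- Together with N ≤ 12k this yields 96u + N ≤ 96u + 12k ≤ 12N.
    max-sat : ∃ λ x → 96 ℕ.* length (filter (unsatisfied? x) L) ℕ.≤ 11 ℕ.* length L
    max-sat = from-kept (maximal-independent meets? L λ {c} c∈ → self-meets c (three c∈))
      where
      open ℕ.≤-Reasoning
      self-meets : ∀ c → length c ≡ 3 → Meets c c
      self-meets (l ∷ c) _ = here (here refl)
      from-kept : (∃ λ cs → cs ⊆ L × AllPairs (λ d c → ¬ Meets d c) cs × (∀ {d} → d ∈ L → Any (Meets d) cs)) →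
                  ∃ λ x → 96 ℕ.* length (filter (unsatisfied? x) L) ℕ.≤ 11 ℕ.* length L
      from-kept (cs , cs⊆L , indep , dom) = from-actives (disjoint-actives L three unique twice cs cs⊆L indep)
        where
        from-actives : (∃ λ Ss → length Ss ≡ length cs × All (Active L three unique twice) Ss × AllPairs Disjoint-vars Ss ×
                                 All (λ S → ∃ λ c → c ∈ cs × vars S ⊆ vars c) Ss) → _
        from-actives (Ss , len , acts , disj , _) = from-gain (total-gain L three unique twice acts disj)
          where
          from-gain : (∃ λ x → eval x (concatMap expand L) ℤ.+ + length Ss ℤ.≤ 0ℤ) → _
          from-gain (x , gain) = x , ℕ.+-cancelʳ-≤ (length L) (96 ℕ.* u) (11 ℕ.* length L) (begin
            96 ℕ.* u ℕ.+ length L                    ≤⟨ ℕ.+-monoʳ-≤ (96 ℕ.* u) (length-≤-dominating cs cs⊆L dom) ⟩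
            96 ℕ.* u ℕ.+ length cs ℕ.* 12            ≡⟨ cong (λ m → 96 ℕ.* u ℕ.+ m ℕ.* 12) len ⟨
            96 ℕ.* u ℕ.+ length Ss ℕ.* 12            ≡⟨ arith u (length Ss) ⟩
            12 ℕ.* (8 ℕ.* u ℕ.+ length Ss)           ≤⟨ ℕ.*-monoʳ-≤ 12 (ℤ.drop‿+≤+ bound) ⟩
            12 ℕ.* length L                          ≡⟨ ℕ.+-comm (length L) (11 ℕ.* length L) ⟩
            11 ℕ.* length L ℕ.+ length L             ∎)
            where
            u = length (filter (unsatisfied? x) L)
            e = eval x (concatMap expand L)
            arith : ∀ u s → 96 ℕ.* u ℕ.+ s ℕ.* 12 ≡ 12 ℕ.* (8 ℕ.* u ℕ.+ s)
            arith = ℕ-solve-∀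
            bound : + (8 ℕ.* u ℕ.+ length Ss) ℤ.≤ + length L
            bound = ℤR.begin
              + (8 ℕ.* u) ℤ.+ + length Ss            ℤR.≤⟨ ℤ.+-monoˡ-≤ (+ length Ss) (unsatisfied-≤-∏ x L three) ⟩
              ∑ (∏ x) L ℤ.+ + length Ss              ℤR.≡⟨ cong (ℤ._+ + length Ss) (∑-∏ x L) ⟩
              (+ length L ℤ.+ e) ℤ.+ + length Ss     ℤR.≡⟨ ℤ.+-assoc (+ length L) e (+ length Ss) ⟩
              + length L ℤ.+ (e ℤ.+ + length Ss)     ℤR.≤⟨ ℤ.+-monoʳ-≤ (+ length L) gain ⟩
              + length L ℤ.+ 0ℤ                      ℤR.≡⟨ ℤ.+-identityʳ (+ length L) ⟩
              + length L                             ℤR.∎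
              where module ℤR = ℤ.≤-Reasoning

-- Cubic graphs and maximal matchings

elements : ∀ {n} → Subset n → List (Fin n)
elements []            = []
elements (inside  ∷ p) = zero ∷ map suc (elements p)
elements (outside ∷ p) = map suc (elements p)

∈-elements⁺ : ∀ {n} {p : Subset n} {v} → v Subset.∈ p → v ∈ elements p
∈-elements⁺ {p = inside  ∷ p} here       = here refl
∈-elements⁺ {p = inside  ∷ p} (there v∈) = there (∈-map⁺ suc (∈-elements⁺ v∈))
∈-elements⁺ {p = outside ∷ p} (there v∈) = ∈-map⁺ suc (∈-elements⁺ v∈)

∈-elements⁻ : ∀ {n} (p : Subset n) {v} → v ∈ elements p → v Subset.∈ p
∈-elements⁻ (inside  ∷ p) (here refl) = here
∈-elements⁻ (inside  ∷ p) (there v∈) with ∈-map⁻ suc v∈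
... | w , w∈ , refl = there (∈-elements⁻ p w∈)
∈-elements⁻ (outside ∷ p) v∈ with ∈-map⁻ suc v∈
... | w , w∈ , refl = there (∈-elements⁻ p w∈)

elements-unique : ∀ {n} (p : Subset n) → Unique (elements p)
elements-unique []            = []
elements-unique (inside  ∷ p) = All.map⁺ (All.universal (λ _ ()) (elements p)) ∷ Unique.map⁺ Fin.suc-injective (elements-unique p)
elements-unique (outside ∷ p) = Unique.map⁺ Fin.suc-injective (elements-unique p)

length-elements : ∀ {n} (p : Subset n) → length (elements p) ≡ ∣ p ∣
length-elements []            = refl
length-elements (inside  ∷ p) = cong ℕ.suc (≡-trans (List.length-map suc (elements p)) (length-elements p))
length-elements (outside ∷ p) = ≡-trans (List.length-map suc (elements p)) (length-elements p)

module _ {n : ℕ} {P : Pred (Fin n) 0ℓ} (P? : Decidable P) where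

  ∈-tabulate-does⁺ : ∀ {v} → P v → v Subset.∈ tabulate (does ∘ P?)
  ∈-tabulate-does⁺ {v} Pv = lookup⇒[]= v _ (≡-trans (lookup∘tabulate (does ∘ P?) v) (dec-true (P? v) Pv))

  ∈-tabulate-does⁻ : ∀ {v} → v Subset.∈ tabulate (does ∘ P?) → P v
  ∈-tabulate-does⁻ {v} v∈ with P? v | ≡-trans (sym (lookup∘tabulate (does ∘ P?) v)) ([]=⇒lookup v∈)
  ... | yes Pv | _  = Pv
  ... | no  _  | ()

length-filter-map : ∀ {A B : Set} {P : Pred B 0ℓ} (P? : Decidable P) (f : A → B) xs →
                    length (filter P? (map f xs)) ≡ length (filter (P? ∘ f) xs)
length-filter-map P? f []       = refl
length-filter-map P? f (x ∷ xs) with P? (f x)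
... | yes _ = cong ℕ.suc (length-filter-map P? f xs)
... | no  _ = length-filter-map P? f xs

occurrences : ∀ {A : Set} (_≟_ : DecidableEquality A) (_∈?_ : ∀ x xs → Dec (x ∈ xs)) x xss →
              (∀ {xs} → xs ∈ xss → Unique xs) →
              length (filter (x ≟_) (concat xss)) ℕ.≤ length (filter (x ∈?_) xss)
occurrences _≟_ _∈?_ x []         u = ℕ.z≤n
occurrences _≟_ _∈?_ x (xs ∷ xss) u
  rewrite List.filter-++ (x ≟_) xs (concat xss) | List.length-++ (filter (x ≟_) xs) {filter (x ≟_) (concat xss)}
  with x ∈? xs
... | no  x∉ rewrite List.filter-none (x ≟_) {xs} (All.¬Any⇒All¬ xs x∉) = occurrences _≟_ _∈?_ x xss (u ∘ there)
... | yes x∈ = ℕ.+-mono-≤ once (occurrences _≟_ _∈?_ x xss (u ∘ there))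
  where
  once : length (filter (x ≟_) xs) ℕ.≤ 1
  once = unique-⊆-length {ys = [ x ]} (Unique.filter⁺ (x ≟_) (u (here refl)))
           (λ y∈ → here (sym (proj₂ (∈-filter⁻ (x ≟_) {xs = xs} y∈))))

-- Here u ≤ 11l/96 and l ≤ 4m/3 give u ≤ 11m/72, whence d ≤ 83m/72; multiplication by 288 = 4 · 72 =
-- 3 · 96 clears the denominators.
72∣D∣≤83∣M∣ : ∀ d m u l → d ℕ.≤ m ℕ.+ u → 96 ℕ.* u ℕ.≤ 11 ℕ.* l → l ℕ.* 3 ℕ.≤ m ℕ.* 4 → 72 ℕ.* d ℕ.≤ 83 ℕ.* m
72∣D∣≤83∣M∣ d m u l d≤ u≤ l≤ = ℕ.*-cancelˡ-≤ 4 (begin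
  4 ℕ.* (72 ℕ.* d)                        ≤⟨ ℕ.*-monoʳ-≤ 4 (ℕ.*-monoʳ-≤ 72 d≤) ⟩
  4 ℕ.* (72 ℕ.* (m ℕ.+ u))                ≡⟨ arith₁ m u ⟩
  288 ℕ.* m ℕ.+ 3 ℕ.* (96 ℕ.* u)          ≤⟨ ℕ.+-monoʳ-≤ (288 ℕ.* m) (ℕ.*-monoʳ-≤ 3 u≤) ⟩
  288 ℕ.* m ℕ.+ 3 ℕ.* (11 ℕ.* l)          ≡⟨ arith₂ m l ⟩
  288 ℕ.* m ℕ.+ 11 ℕ.* (l ℕ.* 3)          ≤⟨ ℕ.+-monoʳ-≤ (288 ℕ.* m) (ℕ.*-monoʳ-≤ 11 l≤) ⟩
  288 ℕ.* m ℕ.+ 11 ℕ.* (m ℕ.* 4)          ≡⟨ arith₃ m ⟩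
  4 ℕ.* (83 ℕ.* m)                        ∎)
  where
  open ℕ.≤-Reasoning
  arith₁ : ∀ m u → 4 ℕ.* (72 ℕ.* (m ℕ.+ u)) ≡ 288 ℕ.* m ℕ.+ 3 ℕ.* (96 ℕ.* u)
  arith₁ = ℕ-solve-∀
  arith₂ : ∀ m l → 288 ℕ.* m ℕ.+ 3 ℕ.* (11 ℕ.* l) ≡ 288 ℕ.* m ℕ.+ 11 ℕ.* (l ℕ.* 3)
  arith₂ = ℕ-solve-∀
  arith₃ : ∀ m → 288 ℕ.* m ℕ.+ 11 ℕ.* (m ℕ.* 4) ≡ 4 ℕ.* (83 ℕ.* m)
  arith₃ = ℕ-solve-∀

module _ {n : ℕ} (G : Graph n) (cubic : Cubic G) where
  open Graph G using (_~_; _~?_) renaming (sym to ~-sym; irrefl to ~-irrefl)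
  open import Data.List.Membership.DecPropositional (Fin._≟_ {n}) using (_∈?_)
  open import Data.List.Membership.DecPropositional (_≟ˡ_ {length (edges G)}) using () renaming (_∈?_ to _∈ˡ?_)
  open import Data.List.Relation.Unary.Unique.DecPropositional (Fin._≟_ {length (edges G)}) using (unique?)

  nbrs : Fin n → List (Fin n)
  nbrs v = elements (neighbours G v)

  ∈-nbrs⁺ : ∀ {v w} → v ~ w → w ∈ nbrs v
  ∈-nbrs⁺ {v} v~w = ∈-elements⁺ (∈-tabulate-does⁺ (v ~?_) v~w)

  ∈-nbrs⁻ : ∀ {v w} → w ∈ nbrs v → v ~ w
  ∈-nbrs⁻ {v} w∈ = ∈-tabulate-does⁻ (v ~?_) (∈-elements⁻ (neighbours G v) w∈)

  length-nbrs : ∀ v → length (nbrs v) ≡ 3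
  length-nbrs v = ≡-trans (length-elements (neighbours G v)) (cubic v)

  Lit : Set
  Lit = Literal {length (edges G)}

  -- The sign `Sign.+` stands for the smaller end of the edge.
  end : Lit → Fin n
  end (e , Sign.+) = proj₁ (lookup (edges G) e)
  end (e , Sign.-) = proj₂ (lookup (edges G) e)

  incident-end : ∀ e s → Incident G (end (e , s)) e
  incident-end e Sign.+ = inj₁ refl
  incident-end e Sign.- = inj₂ refl

  incident⇒end : ∀ {v e} → Incident G v e → ∃ λ s → v ≡ end (e , s)
  incident⇒end (inj₁ eq) = Sign.+ , eq
  incident⇒end (inj₂ eq) = Sign.- , eq

  edge? : ∀ (uv : Fin n × Fin n) → Dec ((proj₁ uv Fin.< proj₂ uv) × (proj₁ uv ~ proj₂ uv))
  edge? (u , v) = (u Fin.<? v) ×-dec (u ~? v)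

  end~end : ∀ e s → end (e , s) ~ end (e , opposite s)
  end~end e s with ∈-filter⁻ edge? {xs = cartesianProduct (allFin n) (allFin n)} (∈-lookup {xs = edges G} e)
  end~end e Sign.+ | _ , _ , u~v = u~v
  end~end e Sign.- | _ , _ , u~v = ~-sym u~v

  edge-index : ∀ {u v} → u ~ v → ∃ λ e → ∃ λ s → u ≡ end (e , s) × v ≡ end (e , opposite s)
  edge-index {u} {v} u~v with Fin.<-cmp u v
  ... | tri≈ _ refl _ = contradiction u~v (~-irrefl refl)
  ... | tri< u<v _ _  = Any.index uv∈ , Sign.+ , cong proj₁ (lookup-index uv∈) , cong proj₂ (lookup-index uv∈)
    where
    uv∈ : (u , v) ∈ edges G
    uv∈ = ∈-filter⁺ edge? (∈-cartesianProduct⁺ (∈-allFin u) (∈-allFin v)) (u<v , u~v)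
  ... | tri> _ _ v<u  = Any.index vu∈ , Sign.- , cong proj₂ (lookup-index vu∈) , cong proj₁ (lookup-index vu∈)
    where
    vu∈ : (v , u) ∈ edges G
    vu∈ = ∈-filter⁺ edge? (∈-cartesianProduct⁺ (∈-allFin v) (∈-allFin u)) (v<u , ~-sym u~v)

  -- The formula of a maximal matching

  module _ {M : EdgeSet G} (maximal : MaximalMatching G M) where

    -- Variables are indexed by all edges of the graph, but only the edges of `M` provide literals
    -- for clauses.
    lits : List Lit
    lits = literals (elements M)

    lits-unique : Unique lits
    lits-unique = literals-unique (elements-unique M)

    ∈-lits⁻ : ∀ {l} → l ∈ lits → proj₁ l Subset.∈ M
    ∈-lits⁻ l∈ = ∈-elements⁻ M (∈-literals⁻ {vs = elements M} l∈)

    ∈-lits⁺ : ∀ {e} s → e Subset.∈ M → (e , s) ∈ lits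
    ∈-lits⁺ s e∈ = ∈-literals⁺ s (∈-elements⁺ e∈)

    -- Different edges of a matching share no end, and the two ends of one edge differ because they
    -- are adjacent.
    end-injective : ∀ {l m} → l ∈ lits → m ∈ lits → end l ≡ end m → l ≡ m
    end-injective {e , s} {f , t} l∈ m∈ eq with e Fin.≟ f
    ... | no  e≢f  = contradiction (incident-end e s , subst (λ v → Incident G v f) (sym eq) (incident-end f t))
                       (proj₁ maximal e f (∈-lits⁻ l∈) (∈-lits⁻ m∈) e≢f (end (e , s)))
    ... | yes refl = cong (e ,_) (same s t eq)
      where
      same : ∀ s t → end (e , s) ≡ end (e , t) → s ≡ t
      same Sign.+ Sign.+ _  = refl
      same Sign.- Sign.- _  = refl
      same Sign.+ Sign.- eq = contradiction (end~end e Sign.+) (~-irrefl eq)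
      same Sign.- Sign.+ eq = contradiction (end~end e Sign.-) (~-irrefl eq)

    covered? : ∀ v → Dec (v ∈ map end lits)
    covered? v = v ∈? map end lits

    -- An edge between two uncovered vertices could be added to `M`, against maximality.
    uncovered-independent : ∀ {u v} → u ∉ map end lits → v ∉ map end lits → ¬ (u ~ v)
    uncovered-independent {u} {v} u∉ v∉ u~v with edge-index u~v
    ... | e , s , refl , refl = proj₂ maximal (M ∪ ⁅ e ⁆) matching
          (p⊆p∪q ⁅ e ⁆ , e , x∈p∪q⁺ (inj₂ (x∈⁅x⁆ e)) , λ e∈ → u∉ (∈-map⁺ end (∈-lits⁺ s e∈)))
      where
      free : ∀ {w f} → Incident G w e → f Subset.∈ M → ¬ Incident G w f
      free {w} {f} w-e f∈ w-f with incident⇒end w-e | incident⇒end w-f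
      ... | r , w≡ | t , w≡′ with r Sign.≟ s
      ... | yes refl = u∉ (subst (_∈ map end lits) (≡-trans (sym w≡′) w≡) (∈-map⁺ end (∈-lits⁺ t f∈)))
      ... | no r≢s = v∉ (subst (_∈ map end lits) (≡-trans (sym w≡′) (≡-trans w≡ (cong (end ∘ (e ,_)) (flipped r s r≢s)))) (∈-map⁺ end (∈-lits⁺ t f∈)))
        where
        flipped : ∀ r s → r ≢ s → r ≡ opposite s
        flipped Sign.+ Sign.+ ne = contradiction refl ne
        flipped Sign.+ Sign.- ne = refl
        flipped Sign.- Sign.+ ne = refl
        flipped Sign.- Sign.- ne = contradiction refl ne
      matching : Matching G (M ∪ ⁅ e ⁆)
      matching f g f∈ g∈ f≢g w (w-f , w-g) with x∈p∪q⁻ M ⁅ e ⁆ f∈ | x∈p∪q⁻ M ⁅ e ⁆ g∈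
      ... | inj₁ f∈M | inj₁ g∈M = proj₁ maximal f g f∈M g∈M f≢g w (w-f , w-g)
      ... | inj₁ f∈M | inj₂ g∈e with refl ← x∈⁅y⁆⇒x≡y e g∈e = free w-g f∈M w-f
      ... | inj₂ f∈e | inj₁ g∈M with refl ← x∈⁅y⁆⇒x≡y e f∈e = free w-f g∈M w-g
      ... | inj₂ f∈e | inj₂ g∈e = f≢g (≡-trans (x∈⁅y⁆⇒x≡y e f∈e) (sym (x∈⁅y⁆⇒x≡y e g∈e)))

    clause : Fin n → List Lit
    clause v = filter (λ l → v ~? end l) lits

    ∈-clause⁻ : ∀ {v l} → l ∈ clause v → l ∈ lits × v ~ end l
    ∈-clause⁻ {v} = ∈-filter⁻ (λ l → v ~? end l) {xs = lits}

    clause-unique : ∀ v → Unique (clause v)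
    clause-unique v = Unique.filter⁺ (λ l → v ~? end l) lits-unique

    map-end-unique : ∀ {ls} → (∀ {l} → l ∈ ls → l ∈ lits) → Unique ls → Unique (map end ls)
    map-end-unique ls⊆ u = AllPairs.map⁺ (AllPairs-map∈ (λ l∈ m∈ l≢m eq → l≢m (end-injective (ls⊆ l∈) (ls⊆ m∈) eq)) u)

    -- All three neighbours of an uncovered vertex are covered, and by injectivity each is the end
    -- for exactly one literal.
    clause-length : ∀ {v} → v ∉ map end lits → length (clause v) ≡ 3
    clause-length {v} v∉ = begin
      length (clause v)            ≡⟨ List.length-map end (clause v) ⟨
      length (map end (clause v))  ≡⟨ ℕ.≤-antisym (unique-⊆-length (map-end-unique (proj₁ ∘ ∈-clause⁻) (clause-unique v)) to)
                                                  (unique-⊆-length (elements-unique (neighbours G v)) from) ⟩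
      length (nbrs v)              ≡⟨ length-nbrs v ⟩
      3                            ∎
      where
      open ≡-Reasoning
      to : map end (clause v) ⊆ nbrs v
      to w∈ with ∈-map⁻ end w∈
      ... | l , l∈ , refl = ∈-nbrs⁺ (proj₂ (∈-clause⁻ l∈))
      from : nbrs v ⊆ map end (clause v)
      from {w} w∈ with covered? w
      ... | no  w∉ = contradiction (∈-nbrs⁻ w∈) (uncovered-independent v∉ w∉)
      ... | yes w∈lits with ∈-map⁻ end w∈lits
      ... | l , l∈ , refl = ∈-map⁺ end (∈-filter⁺ (λ l → v ~? end l) l∈ (∈-nbrs⁻ w∈))

    -- If an uncovered vertex is adjacent to both ends of an edge of `M`, its clause contains a
    -- literal and its negation and is always satisfied. Such vertices are left out, which makes the
    -- variables of every remaining clause distinct.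
    proper? : ∀ v → Dec (v ∉ map end lits × Unique (vars (clause v)))
    proper? v = ¬? (covered? v) ×-dec unique? (vars (clause v))

    proper : List (Fin n)
    proper = filter proper? (allFin n)

    ∈-proper⁻ : ∀ {v} → v ∈ proper → v ∉ map end lits × Unique (vars (clause v))
    ∈-proper⁻ v∈ = proj₂ (∈-filter⁻ proper? {xs = allFin n} v∈)

    formula : List (List Lit)
    formula = map clause proper

    formula-three : ∀ {c} → c ∈ formula → length c ≡ 3
    formula-three c∈ with ∈-map⁻ clause c∈
    ... | v , v∈ , refl = clause-length (proj₁ (∈-proper⁻ v∈))

    formula-unique : ∀ {c} → c ∈ formula → Unique (vars c)
    formula-unique c∈ with ∈-map⁻ clause c∈
    ... | v , v∈ , refl = proj₂ (∈-proper⁻ v∈)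

    -- The end has three neighbours. One of them is its partner in `M`, which is covered and has no
    -- clause in the formula, so at most two clauses contain `l`.
    formula-twice : ∀ l → length (filter (l ≟ˡ_) (concat formula)) ℕ.≤ 2
    formula-twice l = ℕ.≤-trans (occurrences _≟ˡ_ _∈ˡ?_ l formula unique-clause)
                        (ℕ.≤-trans (ℕ.≤-reflexive (length-filter-map (l ∈ˡ?_) clause proper)) bound)
      where
      unique-clause : ∀ {c} → c ∈ formula → Unique c
      unique-clause c∈ with ∈-map⁻ clause c∈
      ... | v , _ , refl = clause-unique v
      holders = filter (λ v → l ∈ˡ? clause v) proper
      ∈-holders⁻ : ∀ {v} → v ∈ holders → v ∈ proper × l ∈ clause v
      ∈-holders⁻ = ∈-filter⁻ (λ v → l ∈ˡ? clause v) {xs = proper}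
      mate : Fin n
      mate = end (proj₁ l , opposite (proj₂ l))
      mate∉ : All (mate ≢_) holders
      mate∉ = All.tabulate λ { v∈ refl →
        proj₁ (∈-proper⁻ (proj₁ (∈-holders⁻ v∈)))
          (∈-map⁺ end (∈-lits⁺ (opposite (proj₂ l)) (∈-lits⁻ (proj₁ (∈-clause⁻ (proj₂ (∈-holders⁻ v∈))))))) }
      bound : length holders ℕ.≤ 2
      bound = ℕ.≤-pred (ℕ.≤-trans
        (unique-⊆-length {xs = mate ∷ holders} {ys = nbrs (end l)}
          (mate∉ ∷ Unique.filter⁺ (λ v → l ∈ˡ? clause v) (Unique.filter⁺ proper? (Unique.allFin⁺ n)))
          λ { (here refl) → ∈-nbrs⁺ (end~end (proj₁ l) (proj₂ l))
            ; (there v∈)  → ∈-nbrs⁺ (~-sym (proj₂ (∈-clause⁻ (proj₂ (∈-holders⁻ v∈))))) })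
        (ℕ.≤-reflexive (length-nbrs (end l))))

    -- Counts literal occurrences: three in each clause, and at most two for each of the 2∣M∣
    -- literals.
    length-formula : length formula ℕ.* 3 ℕ.≤ ∣ M ∣ ℕ.* 4
    length-formula = begin
      length formula ℕ.* 3             ≡⟨ length-concatMap id 3 formula formula-three ⟨
      length (concatMap id formula)    ≡⟨ cong (length ∘ concat) (List.map-id formula) ⟩
      length (concat formula)          ≤⟨ length-≤-cover _≟ˡ_ 2 lits (concat formula) covered (λ {l} _ → formula-twice l) ⟩
      length lits ℕ.* 2                ≡⟨ cong (ℕ._* 2) (≡-trans (length-literals (elements M)) (cong (ℕ._* 2) (length-elements M))) ⟩
      ∣ M ∣ ℕ.* 2 ℕ.* 2                ≡⟨ ℕ.*-assoc ∣ M ∣ 2 2 ⟩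
      ∣ M ∣ ℕ.* 4                      ∎
      where
      open ℕ.≤-Reasoning
      covered : ∀ {l} → l ∈ concat formula → Any (_≡ l) lits
      covered l∈ with ∈-concat⁻′ formula l∈
      ... | _ , l∈c , c∈ with ∈-map⁻ clause c∈
      ... | v , _ , refl = Any.map sym (proj₁ (∈-clause⁻ l∈c))

    -- The dominating set given by an assignment

    module _ (x : Assignment {length (edges G)}) where

      chosen : List (Fin n)
      chosen = map (λ e → end (e , x e)) (elements M)

      unhit : List (Fin n)
      unhit = filter (unsatisfied? x ∘ clause) proper

      dominators : Subset n
      dominators = tabulate (does ∘ (_∈? chosen ++ unhit))

      ∈-dominators : ∀ {v} → v ∈ chosen ++ unhit → v Subset.∈ dominators
      ∈-dominators = ∈-tabulate-does⁺ (_∈? chosen ++ unhit)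

      ∣dominators∣ : ∣ dominators ∣ ℕ.≤ ∣ M ∣ ℕ.+ length (filter (unsatisfied? x) formula)
      ∣dominators∣ = begin
        ∣ dominators ∣                        ≡⟨ length-elements dominators ⟨
        length (elements dominators)          ≤⟨ unique-⊆-length (elements-unique dominators)
                                                   (λ v∈ → ∈-tabulate-does⁻ (_∈? chosen ++ unhit) (∈-elements⁻ dominators v∈)) ⟩
        length (chosen ++ unhit)              ≡⟨ List.length-++ chosen ⟩
        length chosen ℕ.+ length unhit        ≡⟨ cong₂ ℕ._+_ (≡-trans (List.length-map _ (elements M)) (length-elements M))
                                                             (sym (length-filter-map (unsatisfied? x) clause proper)) ⟩
        ∣ M ∣ ℕ.+ length (filter (unsatisfied? x) formula) ∎
        where open ℕ.≤-Reasoning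

      chosen∈ : ∀ {e} → e Subset.∈ M → end (e , x e) Subset.∈ dominators
      chosen∈ e∈ = ∈-dominators (∈-++⁺ˡ (∈-map⁺ (λ e → end (e , x e)) (∈-elements⁺ e∈)))

      False⇒opposite : ∀ e s → False x (e , s) → s ≡ opposite (x e)
      False⇒opposite e s f with s | x e
      ... | Sign.+ | Sign.- = refl
      ... | Sign.- | Sign.+ = refl

      ¬False⇒≡ : ∀ e s → ¬ False x (e , s) → s ≡ x e
      ¬False⇒≡ e s ¬f with s | x e
      ... | Sign.+ | Sign.+ = refl
      ... | Sign.- | Sign.- = refl
      ... | Sign.+ | Sign.- = contradiction refl ¬f
      ... | Sign.- | Sign.+ = contradiction refl ¬f

      -- A covered vertex that was not chosen is adjacent to its chosen partner. An uncovered vertex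
      -- has a chosen neighbour if its clause is satisfied, and otherwise belongs to `unhit`.
      dominating : Dominating G dominators
      dominating v v∉ with covered? v
      ... | no v-free = uncovered-case (unsatisfied? x (clause v))
        where
        -- A variable and its negation are never both false, so a vertex with an unsatisfied clause
        -- is always in `proper`.
        unique-vars : Unsatisfied x (clause v) → Unique (vars (clause v))
        unique-vars unsat = AllPairs.map⁺ (AllPairs-map∈ (λ { {e , s} {_ , t} l∈ m∈ l≢m refl → l≢m (cong (e ,_)
          (≡-trans (False⇒opposite e s (All.lookup unsat l∈)) (sym (False⇒opposite e t (All.lookup unsat m∈))))) }) (clause-unique v))
        uncovered-case : Dec (Unsatisfied x (clause v)) → ∃ λ u → u Subset.∈ dominators × v ~ u
        uncovered-case (yes unsat) = contradiction (∈-dominators (∈-++⁺ʳ chosen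
          (∈-filter⁺ (unsatisfied? x ∘ clause) (∈-filter⁺ proper? (∈-allFin v) (v-free , unique-vars unsat)) unsat))) v∉
        uncovered-case (no sat) = hit (find (All.¬All⇒Any¬ (false? x) (clause v) sat))
          where
          hit : (∃ λ l → l ∈ clause v × ¬ False x l) → ∃ λ u → u Subset.∈ dominators × v ~ u
          hit ((e , s) , l∈ , ¬f) = end (e , x e) , chosen∈ (∈-lits⁻ (proj₁ (∈-clause⁻ l∈))) ,
                                    subst (λ t → v ~ end (e , t)) (¬False⇒≡ e s ¬f) (proj₂ (∈-clause⁻ l∈))
      ... | yes v∈ = covered-case (∈-map⁻ end v∈)
        where
        covered-case : (∃ λ l → l ∈ lits × v ≡ end l) → ∃ λ u → u Subset.∈ dominators × v ~ u
        covered-case ((e , s) , l∈ , v≡) = by-truth (false? x (e , s))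
          where
          by-truth : Dec (False x (e , s)) → ∃ λ u → u Subset.∈ dominators × v ~ u
          by-truth (no ¬f) = contradiction
            (subst (Subset._∈ dominators) (sym (≡-trans v≡ (cong (end ∘ (e ,_)) (¬False⇒≡ e s ¬f)))) (chosen∈ (∈-lits⁻ l∈))) v∉
          by-truth (yes f) = end (e , x e) , chosen∈ (∈-lits⁻ l∈) ,
            subst (_~ end (e , x e)) (sym (≡-trans v≡ (cong (end ∘ (e ,_)) (False⇒opposite e s f)))) (~-sym (end~end e (x e)))

    small-dominating : ∃ λ D → Dominating G D × 72 ℕ.* ∣ D ∣ ℕ.≤ 83 ℕ.* ∣ M ∣
    small-dominating = from (max-sat formula formula-three formula-unique formula-twice)
      where
      from : (∃ λ x → 96 ℕ.* length (filter (unsatisfied? x) formula) ℕ.≤ 11 ℕ.* length formula) →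
             ∃ λ D → Dominating G D × 72 ℕ.* ∣ D ∣ ℕ.≤ 83 ℕ.* ∣ M ∣
      from (x , u≤) = dominators x , dominating x ,
        72∣D∣≤83∣M∣ (∣ dominators x ∣) (∣ M ∣) (length (filter (unsatisfied? x) formula)) (length formula) (∣dominators∣ x) u≤ length-formula

  72γ≤83γₑ : 72 ℕ.* γ G ℕ.≤ 83 ℕ.* γₑ G
  72γ≤83γₑ = from (proj₂ (domination G)) (proj₂ (edgeDomination G))
    where
    from : IsMinCardinality (Dominating G) (γ G) → IsMinCardinality (MaximalMatching G) (γₑ G) → 72 ℕ.* γ G ℕ.≤ 83 ℕ.* γₑ G
    from (_ , γ≤) ((M , maximal , ∣M∣≡) , _) = conclude (small-dominating maximal)
      where
      conclude : (∃ λ D → Dominating G D × 72 ℕ.* ∣ D ∣ ℕ.≤ 83 ℕ.* ∣ M ∣) → 72 ℕ.* γ G ℕ.≤ 83 ℕ.* γₑ G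
      conclude (D , dom , D≤) = ℕ.≤-trans (ℕ.*-monoʳ-≤ 72 (γ≤ D dom)) (subst (λ m → 72 ℕ.* ∣ D ∣ ℕ.≤ 83 ℕ.* m) ∣M∣≡ D≤)

-- Passage to the stated constant

72a≤83b⇒68a≤79b : ∀ a b → 72 ℕ.* a ℕ.≤ 83 ℕ.* b → a ℕ.* 68 ℕ.≤ 79 ℕ.* b
72a≤83b⇒68a≤79b a b 72a≤83b = ℕ.*-cancelˡ-≤ 72 (begin
  72 ℕ.* (a ℕ.* 68)                  ≡⟨ arith₁ a ⟩
  68 ℕ.* (72 ℕ.* a)                  ≤⟨ ℕ.*-monoʳ-≤ 68 72a≤83b ⟩
  -- The slack is 44 = 72 · 79 - 68 · 83.
  68 ℕ.* (83 ℕ.* b)                  ≤⟨ ℕ.m≤m+n (68 ℕ.* (83 ℕ.* b)) (44 ℕ.* b) ⟩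
  68 ℕ.* (83 ℕ.* b) ℕ.+ 44 ℕ.* b     ≡⟨ arith₂ b ⟩
  72 ℕ.* (79 ℕ.* b)                  ∎)
  where
  open ℕ.≤-Reasoning
  arith₁ : ∀ a → 72 ℕ.* (a ℕ.* 68) ≡ 68 ℕ.* (72 ℕ.* a)
  arith₁ = ℕ-solve-∀
  arith₂ : ∀ b → 68 ℕ.* (83 ℕ.* b) ℕ.+ 44 ℕ.* b ≡ 72 ℕ.* (79 ℕ.* b)
  arith₂ = ℕ-solve-∀

theorem2 : ∀ {n : ℕ} (G : Graph n) → Cubic G →
    (+ γ G / 1) ≤ ((+ 7 / 6) - (+ 1 / 204)) * (+ γₑ G / 1)
theorem2 G cubic = ℚ.toℚᵘ-cancel-≤ (begin
  toℚᵘ (+ γ G / 1)                                       ≃⟨ ℚ.toℚᵘ-fromℚᵘ (mkℚᵘ (+ γ G) 0) ⟩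
  -- The constant is 7/6 - 1/204 = 79/68, written `mkℚᵘ (+ 79) 67` because denominators are stored
  -- less one.
  mkℚᵘ (+ γ G) 0                                         ≤⟨ *≤* cross ⟩
  mkℚᵘ (+ 79) 67 ℚᵘ.* mkℚᵘ (+ γₑ G) 0                    ≃⟨ ℚᵘ.*-congˡ {mkℚᵘ (+ 79) 67} (ℚ.toℚᵘ-fromℚᵘ (mkℚᵘ (+ γₑ G) 0)) ⟨
  mkℚᵘ (+ 79) 67 ℚᵘ.* toℚᵘ (+ γₑ G / 1)                  ≃⟨ ℚ.toℚᵘ-homo-* ((+ 7 / 6) - (+ 1 / 204)) (+ γₑ G / 1) ⟨
  toℚᵘ (((+ 7 / 6) - (+ 1 / 204)) * (+ γₑ G / 1))        ∎)
  where
  open ℚᵘ.≤-Reasoning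
  cross : + γ G ℤ.* + 68 ℤ.≤ (+ 79 ℤ.* + γₑ G) ℤ.* + 1
  cross = subst (+ γ G ℤ.* + 68 ℤ.≤_) (sym (ℤ.*-identityʳ (+ 79 ℤ.* + γₑ G)))
    (subst₂ ℤ._≤_ (ℤ.pos-* (γ G) 68) (ℤ.pos-* 79 (γₑ G)) (ℤ.+≤+ (72a≤83b⇒68a≤79b (γ G) (γₑ G) (72γ≤83γₑ G cubic))))
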